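{- Let $\mathrm{pa17}$ be the sentence $\forall x\,\forall y\,\bigl(y\ne0\rightarrow\exists q\,\exists r\,(r<y\land x=q\cdot y+r)\bigr)$. Then $$\mathrm{PA}_{\mathrm{smu}}^{ - }\cup\operatorname{Th}_{\forall}(\mathfrak N_0)\nvdash\mathrm{pa17}.$$ In particular, $\mathrm{PA}_{\mathrm{smu}}^{ - }\nvdash\mathrm{pa17}$.
   Context: The base language is $\mathcal L_0=\{0,1,+,\cdot,\le\}$ (first-order logic with equality). Abbreviations: $2:=1+1$; $x<y$ means $x\le y\land x\ne y$; $x\mid y$ means $\exists z\,(z\cdot x=y)$; $\operatorname{pow}_2(x)$ means $\forall y\,(y\mid x\rightarrow(y=1\lor 2\mid y))$. $\mathrm{PA}_{\mathrm{smu}}^{ - }$ is the $\mathcal L_0$-theory whose axioms are the universal closures of: (pa1) $x+0=x$; (pa2) $x+y=y+x$; (pa3) $(x+y)+z=x+(y+z)$; (pa4) $x\cdot1=x$; (pa5) $x\cdot y=y\cdot x$; (pa6) $(x\cdot y)\cdot z=x\cdot(y\cdot z)$; (pa7) $x\cdot(y+z)=x\cdot y+x\cdot z$; (pa8) $x\le y\lor y\le x$; (pa9) $(x\le y\land y\le z)\rightarrow x\le z$; (pa10) $\neg(x+1\le x)$; (pa11) $y\le x\rightarrow(y=x\lor y+1\le x)$; (pa12) $y\le x\rightarrow y+z\le x+z$; (pa13) $y\le x\rightarrow y\cdot z\le x\cdot z$; (pa15) $y\le x\rightarrow\exists z\,(x=y+z)$; (pa19) $\exists u\,(\operatorname{pow}_2(u)\land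 u\le x+1\land x+1<2\cdot u)$; (pa20) $(\operatorname{pow}_2(x)\land\operatorname{pow}_2(y)\land x\le y)\rightarrow x\mid y$. $\mathfrak N_0=(\mathbb N;0,1,+,\cdot,\le)$ is the standard model ($0\in\mathbb N$). $\operatorname{Th}_{\forall}(\mathfrak N_0)$ is the set of all universal $\mathcal L_0$-sentences (a block of universal quantifiers followed by a quantifier-free formula) true in $\mathfrak N_0$. $\vdash$ is provability in first-order logic with equality. -}

module Defs where

open import Data.Empty using (⊥)
open import Data.Fin using (Fin; zero; suc)
open import Data.Fin.Patterns using (0F; 1F; 2F)
open import Data.List using (List; []; _∷_; map)
open import Data.List.Membership.Propositional using (_∈_)
import Data.Nat as ℕ
open import Data.Nat using (ℕ; zero; suc)
open import Data.Product using (_×_; ∃-syntax)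
open import Data.Sum using (_⊎_)
open import Data.Vec.Functional using (Vector) renaming ([] to []ᵛ; _∷_ to _∷ᵛ_)
open import Function using (_∘_)
open import Level using (0ℓ)
open import Relation.Binary.PropositionalEquality using (_≡_)
open import Relation.Unary using (Pred)

infixl 9 _⊙_
infixl 8 _⊕_
infix  7 _≐_ _≼_ _≺_ _∣_
infix  6 ¬̇_
infixr 5 _∧_
infixr 4 _∨_
infixr 3 _⇒_
infixr 2 ∀̇_ ∃̇_
infix  1 _⍮_⊢_ _⊢_ _⊨_

------------------------------------------------------------------------
-- Syntax of first-order logic with equality over {0, 1, +, ·, ≤}

-- Well-scoped de Bruijn syntax: n bounds the number of free variables,
-- and the variable 0F refers to the innermost quantifier.

data Term (n : ℕ) : Set where
  var     : Fin n → Term n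
  𝟘 𝟙     : Term n
  _⊕_ _⊙_ : Term n → Term n → Term n

data Formula (n : ℕ) : Set where
  _≐_ _≼_     : Term n → Term n → Formula n
  ⊥̇           : Formula n
  _⇒_ _∧_ _∨_ : Formula n → Formula n → Formula n
  ∀̇_ ∃̇_       : Formula (suc n) → Formula n

¬̇_ : ∀ {n} → Formula n → Formula n
¬̇ φ = φ ⇒ ⊥̇

Sentence : Set
Sentence = Formula 0

Theory : Set₁
Theory = Pred Sentence 0ℓ

∀-closure : ∀ {n} → Formula n → Sentence
∀-closure {zero}  φ = φ
∀-closure {suc n} φ = ∀-closure (∀̇ φ)

data QuantifierFree {n : ℕ} : Formula n → Set where
  _≐_ : ∀ s t → QuantifierFree (s ≐ t)
  _≼_ : ∀ s t → QuantifierFree (s ≼ t)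
  ⊥̇   : QuantifierFree ⊥̇
  _⇒_ : ∀ {φ ψ} → QuantifierFree φ → QuantifierFree ψ → QuantifierFree (φ ⇒ ψ)
  _∧_ : ∀ {φ ψ} → QuantifierFree φ → QuantifierFree ψ → QuantifierFree (φ ∧ ψ)
  _∨_ : ∀ {φ ψ} → QuantifierFree φ → QuantifierFree ψ → QuantifierFree (φ ∨ ψ)

------------------------------------------------------------------------
-- Renaming and substitution

renᵗ : ∀ {m n} → (Fin m → Fin n) → Term m → Term n
renᵗ ρ (var i) = var (ρ i)
renᵗ ρ 𝟘       = 𝟘
renᵗ ρ 𝟙       = 𝟙
renᵗ ρ (s ⊕ t) = renᵗ ρ s ⊕ renᵗ ρ t
renᵗ ρ (s ⊙ t) = renᵗ ρ s ⊙ renᵗ ρ t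

↑ᵗ : ∀ {n} → Term n → Term (suc n)
↑ᵗ = renᵗ suc

subᵗ : ∀ {m n} → (Fin m → Term n) → Term m → Term n
subᵗ σ (var i) = σ i
subᵗ σ 𝟘       = 𝟘
subᵗ σ 𝟙       = 𝟙
subᵗ σ (s ⊕ t) = subᵗ σ s ⊕ subᵗ σ t
subᵗ σ (s ⊙ t) = subᵗ σ s ⊙ subᵗ σ t

lift : ∀ {m n} → (Fin m → Term n) → Fin (suc m) → Term (suc n)
lift σ zero    = var zero
lift σ (suc i) = ↑ᵗ (σ i)

sub : ∀ {m n} → (Fin m → Term n) → Formula m → Formula n
sub σ (s ≐ t) = subᵗ σ s ≐ subᵗ σ t
sub σ (s ≼ t) = subᵗ σ s ≼ subᵗ σ t
sub σ ⊥̇       = ⊥̇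
sub σ (φ ⇒ ψ) = sub σ φ ⇒ sub σ ψ
sub σ (φ ∧ ψ) = sub σ φ ∧ sub σ ψ
sub σ (φ ∨ ψ) = sub σ φ ∨ sub σ ψ
sub σ (∀̇ φ)   = ∀̇ sub (lift σ) φ
sub σ (∃̇ φ)   = ∃̇ sub (lift σ) φ

↑ : ∀ {n} → Formula n → Formula (suc n)
↑ = sub (var ∘ suc)

_[_] : ∀ {n} → Formula (suc n) → Term n → Formula n
φ [ t ] = sub (t ∷ᵛ var) φ

------------------------------------------------------------------------
-- Provability: classical natural deduction with equality

-- The index n is the number of eigenvariables in scope. Since 𝟘 is a
-- closed term, tracking them does not lead to a logic that admits the
-- empty domain.

data _⍮_⊢_ (T : Theory) {n : ℕ} (Γ : List (Formula n)) : Formula n → Set where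
  axiom   : ∀ {φ} → T φ → T ⍮ Γ ⊢ sub []ᵛ φ
  hyp     : ∀ {φ} → φ ∈ Γ → T ⍮ Γ ⊢ φ
  raa     : ∀ {φ} → T ⍮ (¬̇ φ) ∷ Γ ⊢ ⊥̇ → T ⍮ Γ ⊢ φ
  ⇒-intro : ∀ {φ ψ} → T ⍮ φ ∷ Γ ⊢ ψ → T ⍮ Γ ⊢ φ ⇒ ψ
  ⇒-elim  : ∀ {φ ψ} → T ⍮ Γ ⊢ φ ⇒ ψ → T ⍮ Γ ⊢ φ → T ⍮ Γ ⊢ ψ
  ∧-intro : ∀ {φ ψ} → T ⍮ Γ ⊢ φ → T ⍮ Γ ⊢ ψ → T ⍮ Γ ⊢ φ ∧ ψ
  ∧-elimˡ : ∀ {φ ψ} → T ⍮ Γ ⊢ φ ∧ ψ → T ⍮ Γ ⊢ φ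
  ∧-elimʳ : ∀ {φ ψ} → T ⍮ Γ ⊢ φ ∧ ψ → T ⍮ Γ ⊢ ψ
  ∨-introˡ : ∀ {φ ψ} → T ⍮ Γ ⊢ φ → T ⍮ Γ ⊢ φ ∨ ψ
  ∨-introʳ : ∀ {φ ψ} → T ⍮ Γ ⊢ ψ → T ⍮ Γ ⊢ φ ∨ ψ
  ∨-elim  : ∀ {φ ψ χ} → T ⍮ Γ ⊢ φ ∨ ψ →
            T ⍮ φ ∷ Γ ⊢ χ → T ⍮ ψ ∷ Γ ⊢ χ → T ⍮ Γ ⊢ χ
  ∀-intro : ∀ {φ} → T ⍮ map ↑ Γ ⊢ φ → T ⍮ Γ ⊢ ∀̇ φ
  ∀-elim  : ∀ {φ} → T ⍮ Γ ⊢ ∀̇ φ → ∀ t → T ⍮ Γ ⊢ φ [ t ]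
  ∃-intro : ∀ {φ} t → T ⍮ Γ ⊢ φ [ t ] → T ⍮ Γ ⊢ ∃̇ φ
  ∃-elim  : ∀ {φ χ} → T ⍮ Γ ⊢ ∃̇ φ → T ⍮ φ ∷ map ↑ Γ ⊢ ↑ χ → T ⍮ Γ ⊢ χ
  ≐-refl  : ∀ t → T ⍮ Γ ⊢ t ≐ t
  ≐-subst : ∀ φ {s t} → T ⍮ Γ ⊢ s ≐ t → T ⍮ Γ ⊢ φ [ s ] → T ⍮ Γ ⊢ φ [ t ]

_⊢_ : Theory → Sentence → Set
T ⊢ φ = T ⍮ [] ⊢ φ

------------------------------------------------------------------------
-- The standard model and its universal theory

⟦_⟧ : ∀ {n} → Term n → Vector ℕ n → ℕ
⟦ var i ⟧ ρ = ρ i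
⟦ 𝟘     ⟧ ρ = 0
⟦ 𝟙     ⟧ ρ = 1
⟦ s ⊕ t ⟧ ρ = ⟦ s ⟧ ρ ℕ.+ ⟦ t ⟧ ρ
⟦ s ⊙ t ⟧ ρ = ⟦ s ⟧ ρ ℕ.* ⟦ t ⟧ ρ

_⊨_ : ∀ {n} → Vector ℕ n → Formula n → Set
ρ ⊨ s ≐ t = ⟦ s ⟧ ρ ≡ ⟦ t ⟧ ρ
ρ ⊨ s ≼ t = ⟦ s ⟧ ρ ℕ.≤ ⟦ t ⟧ ρ
ρ ⊨ ⊥̇     = ⊥
ρ ⊨ φ ⇒ ψ = ρ ⊨ φ → ρ ⊨ ψ
ρ ⊨ φ ∧ ψ = (ρ ⊨ φ) × (ρ ⊨ ψ)
ρ ⊨ φ ∨ ψ = (ρ ⊨ φ) ⊎ (ρ ⊨ ψ)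
ρ ⊨ ∀̇ φ   = ∀ a → a ∷ᵛ ρ ⊨ φ
ρ ⊨ ∃̇ φ   = ∃[ a ] (a ∷ᵛ ρ ⊨ φ)

𝔑₀⊨_ : Sentence → Set
𝔑₀⊨ φ = []ᵛ ⊨ φ

-- Quantifier-free formulas are decidable in ℕ, so for the sentences
-- below the constructive reading of 𝔑₀⊨_ agrees with classical truth.

data Th∀[𝔑₀] : Theory where
  true : ∀ {n} {φ : Formula n} → QuantifierFree φ →
         𝔑₀⊨ ∀-closure φ → Th∀[𝔑₀] (∀-closure φ)

------------------------------------------------------------------------
-- The theory PA⁻smu and Euclidean division

𝟚 : ∀ {n} → Term n
𝟚 = 𝟙 ⊕ 𝟙

_≺_ : ∀ {n} → Term n → Term n → Formula n
s ≺ t = s ≼ t ∧ ¬̇ (s ≐ t)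

_∣_ : ∀ {n} → Term n → Term n → Formula n
s ∣ t = ∃̇ (var 0F ⊙ ↑ᵗ s ≐ ↑ᵗ t)

pow₂ : ∀ {n} → Term n → Formula n
pow₂ t = ∀̇ (var 0F ∣ ↑ᵗ t ⇒ var 0F ≐ 𝟙 ∨ 𝟚 ∣ var 0F)

module _ where
  private
    x : ∀ {n} → Term (1 ℕ.+ n)
    x = var 0F

    y : ∀ {n} → Term (2 ℕ.+ n)
    y = var 1F

    z : ∀ {n} → Term (3 ℕ.+ n)
    z = var 2F

  data PA⁻smu : Theory where
    pa1  : PA⁻smu (∀-closure {1} (x ⊕ 𝟘 ≐ x))
    pa2  : PA⁻smu (∀-closure {2} (x ⊕ y ≐ y ⊕ x))
    pa3  : PA⁻smu (∀-closure {3} ((x ⊕ y) ⊕ z ≐ x ⊕ (y ⊕ z)))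
    pa4  : PA⁻smu (∀-closure {1} (x ⊙ 𝟙 ≐ x))
    pa5  : PA⁻smu (∀-closure {2} (x ⊙ y ≐ y ⊙ x))
    pa6  : PA⁻smu (∀-closure {3} ((x ⊙ y) ⊙ z ≐ x ⊙ (y ⊙ z)))
    pa7  : PA⁻smu (∀-closure {3} (x ⊙ (y ⊕ z) ≐ x ⊙ y ⊕ x ⊙ z))
    pa8  : PA⁻smu (∀-closure {2} (x ≼ y ∨ y ≼ x))
    pa9  : PA⁻smu (∀-closure {3} (x ≼ y ∧ y ≼ z ⇒ x ≼ z))
    pa10 : PA⁻smu (∀-closure {1} (¬̇ (x ⊕ 𝟙 ≼ x)))
    pa11 : PA⁻smu (∀-closure {2} (y ≼ x ⇒ y ≐ x ∨ y ⊕ 𝟙 ≼ x))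
    pa12 : PA⁻smu (∀-closure {3} (y ≼ x ⇒ y ⊕ z ≼ x ⊕ z))
    pa13 : PA⁻smu (∀-closure {3} (y ≼ x ⇒ y ⊙ z ≼ x ⊙ z))
    pa15 : PA⁻smu (∀-closure {2} (y ≼ x ⇒ (∃̇ ↑ᵗ x ≐ ↑ᵗ y ⊕ var 0F)))
    pa19 : PA⁻smu (∀-closure {1} (∃̇ pow₂ (var 0F)
                                    ∧ var 0F ≼ ↑ᵗ x ⊕ 𝟙
                                    ∧ ↑ᵗ x ⊕ 𝟙 ≺ 𝟚 ⊙ var 0F))
    pa20 : PA⁻smu (∀-closure {2} (pow₂ x ∧ pow₂ y ∧ x ≼ y ⇒ x ∣ y))

pa17 : Sentence
pa17 = ∀̇ ∀̇ (¬̇ (y ≐ 𝟘) ⇒ (∃̇ ∃̇ r ≺ ↑ᵗ (↑ᵗ y) ∧ ↑ᵗ (↑ᵗ x) ≐ q ⊙ ↑ᵗ (↑ᵗ y) ⊕ r))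
  where
  x y : Term 2
  x = var 1F
  y = var 0F

  q r : Term 4
  q = var 1F
  r = var 0F

{-# OPTIONS --safe #-}

-- The non-negative part of ℤ + t·ℤ[½][t], with t infinitely large, is a model
-- of both theories. Taking t = 2ⁿ turns its elements into sequences f : ℕ → ℕ
-- with 2ᶜ·f(n) = P(2ⁿ) for some c, some P ∈ ℤ[X] and all large n, under
-- pointwise operations and up to eventual equality. Each quantifier-free
-- formula is eventually true or eventually false along such sequences, so true
-- universal sentences persist. The powers of two of the model are the monomials
-- 2ᵃtⁱ, which are linearly ordered by divisibility and bracket every positive
-- element; but t cannot be divided by 3, since t/3 has no dyadic coefficient.

module Submission where

open import Defs
open import Data.Empty using (⊥; ⊥-elim)
open import Data.Fin using (Fin; zero; suc)
open import Data.Fin.Patterns using (0F; 1F)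
import Data.Integer as ℤ
open import Data.Integer using (ℤ; +_; -[1+_]; 0ℤ; 1ℤ; -1ℤ; ∣_∣)
import Data.Integer.Divisibility.Signed as ℤ∣
import Data.Integer.Properties as ℤₚ
open import Data.Integer.Tactic.RingSolver using (solve-∀)
open import Data.List using (List; []; _∷_; map)
open import Data.List.Relation.Unary.All as All using (All; []; _∷_)
import Data.List.Relation.Unary.All.Properties as Allₚ
import Data.Nat as ℕ
open import Data.Nat using (ℕ; zero; suc; _⊔_)
import Data.Nat.Divisibility as ℕ∣
import Data.Nat.DivMod as ℕ÷
open import Data.Nat.Induction using (<-wellFounded)
open import Data.Nat.Primality using (prime[2]; euclidsLemma)
import Data.Nat.Properties as ℕₚ
open import Data.Product using (_×_; _,_; proj₁; proj₂; ∃-syntax)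
open import Data.Sum using (_⊎_; inj₁; inj₂; [_,_]′) renaming (map to ⊎-map)
open import Data.Vec.Functional using (Vector) renaming ([] to []ᵛ; _∷_ to _∷ᵛ_)
open import Function using (_∘_; id)
open import Induction.WellFounded using (Acc; acc)
open import Relation.Binary.PropositionalEquality
  using (_≡_; refl; sym; trans; cong; cong₂; subst; subst₂; module ≡-Reasoning)
open import Relation.Nullary using (¬_; yes; no)
open import Relation.Nullary.Negation using (negated-stable; contradiction; ¬¬-map)
open import Relation.Unary using (_∪_)

-- Dyadic coefficients are forced by the bracketing axiom: in ℤ[t] the element t would be a divisor
-- of itself that is neither 1 nor even, the only powers of two would be the standard ones, and none
-- could bracket t. Constant terms must stay integral all the same, or the order would not be
-- discrete. Integer-valued sequences with a denominator 2ᶜ meet both demands at once: if 2ᶜ·f(n) =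
-- P(2ⁿ) for large n, integrality of f(n) makes 2ᶜ divide P(0) and asks nothing of the other
-- coefficients, because 2ⁿ absorbs the denominator there.

Eventually : (ℕ → Set) → Set
Eventually P = ∃[ N ] ∀ n → N ℕ.≤ n → P n

beyond : ∀ N → Eventually (N ℕ.≤_)
beyond N = N , λ _ → id

always : ∀ {P : ℕ → Set} → (∀ n → P n) → Eventually P
always p = 0 , λ n _ → p n

ev-map : ∀ {P Q : ℕ → Set} → (∀ n → P n → Q n) → Eventually P → Eventually Q
ev-map f (N , p) = N , λ n N≤n → f n (p n N≤n)

ev-zip : ∀ {P Q R : ℕ → Set} → (∀ n → P n → Q n → R n) →
         Eventually P → Eventually Q → Eventually R
ev-zip f (M , p) (N , q) = M ⊔ N , λ n le →
  f n (p n (ℕₚ.≤-trans (ℕₚ.m≤m⊔n M N) le)) (q n (ℕₚ.≤-trans (ℕₚ.m≤n⊔m M N) le))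

ev-absurd : Eventually (λ _ → ⊥) → ⊥
ev-absurd (N , p) = p N ℕₚ.≤-refl

-- Powers of two

pow : ℕ → ℤ
pow n = + (2 ℕ.^ n)

pow-+ : ∀ m n → pow (m ℕ.+ n) ≡ pow m ℤ.* pow n
pow-+ m n = trans (cong +_ (ℕₚ.^-distribˡ-+-* 2 m n)) (ℤₚ.pos-* (2 ℕ.^ m) (2 ℕ.^ n))

2^≢0 : ∀ n → ℕ.NonZero (2 ℕ.^ n)
2^≢0 n = ℕₚ.m^n≢0 2 n

n<2^n : ∀ n → n ℕ.< 2 ℕ.^ n
n<2^n zero    = ℕ.s≤s ℕ.z≤n
n<2^n (suc n) = begin-strict
  suc n                     ≡⟨ ℕₚ.+-comm 1 n ⟩
  n ℕ.+ 1                   <⟨ ℕₚ.+-mono-<-≤ (n<2^n n) (ℕₚ.m^n>0 2 n) ⟩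
  2 ℕ.^ n ℕ.+ 2 ℕ.^ n        ≡⟨ cong (2 ℕ.^ n ℕ.+_) (sym (ℕₚ.+-identityʳ _)) ⟩
  2 ℕ.^ suc n               ∎
  where open ℕₚ.≤-Reasoning

2^-mono-≤ : ∀ {m n} → m ℕ.≤ n → 2 ℕ.^ m ℕ.≤ 2 ℕ.^ n
2^-mono-≤ = ℕₚ.^-monoʳ-≤ 2

2^-cancel-≤ : ∀ {m n} → 2 ℕ.^ m ℕ.≤ 2 ℕ.^ n → m ℕ.≤ n
2^-cancel-≤ {m} {n} le with m ℕ.≤? n
... | yes m≤n = m≤n
... | no  m≰n = ⊥-elim (ℕₚ.<⇒≱ (ℕₚ.^-monoʳ-< 2 (ℕ.s≤s (ℕ.s≤s ℕ.z≤n)) (ℕₚ.≰⇒> m≰n)) le)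

2^-cancel-< : ∀ {m n} → 2 ℕ.^ m ℕ.< 2 ℕ.^ n → m ℕ.< n
2^-cancel-< {m} {n} lt with m ℕ.<? n
... | yes m<n = m<n
... | no  m≮n = ⊥-elim (ℕₚ.<⇒≱ lt (2^-mono-≤ (ℕₚ.≮⇒≥ m≮n)))

-- Integer polynomials evaluated at 2ⁿ

-- Coefficients come lowest degree first, and eval P n is P(2ⁿ).

Poly : Set
Poly = List ℤ

eval : Poly → ℕ → ℤ
eval []      n = 0ℤ
eval (a ∷ P) n = a ℤ.+ pow n ℤ.* eval P n

infixl 6 _⊞_
infixl 7 _⊠_ _⊡_

_⊞_ : Poly → Poly → Poly
[]      ⊞ Q       = Q
(a ∷ P) ⊞ []      = a ∷ P
(a ∷ P) ⊞ (b ∷ Q) = a ℤ.+ b ∷ P ⊞ Q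

_⊡_ : ℤ → Poly → Poly
k ⊡ P = map (k ℤ.*_) P

_⊠_ : Poly → Poly → Poly
[]      ⊠ Q = []
(a ∷ P) ⊠ Q = a ⊡ Q ⊞ (0ℤ ∷ P ⊠ Q)

eval-⊞ : ∀ P Q n → eval (P ⊞ Q) n ≡ eval P n ℤ.+ eval Q n
eval-⊞ []      Q       n = sym (ℤₚ.+-identityˡ _)
eval-⊞ (a ∷ P) []      n = sym (ℤₚ.+-identityʳ _)
eval-⊞ (a ∷ P) (b ∷ Q) n =
  trans (cong (λ e → a ℤ.+ b ℤ.+ pow n ℤ.* e) (eval-⊞ P Q n))
        (lemma a b (pow n) (eval P n) (eval Q n))
  where
  lemma : ∀ a b x p q →
          a ℤ.+ b ℤ.+ x ℤ.* (p ℤ.+ q) ≡ (a ℤ.+ x ℤ.* p) ℤ.+ (b ℤ.+ x ℤ.* q)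
  lemma = solve-∀

eval-⊡ : ∀ k P n → eval (k ⊡ P) n ≡ k ℤ.* eval P n
eval-⊡ k []      n = sym (ℤₚ.*-zeroʳ k)
eval-⊡ k (a ∷ P) n =
  trans (cong (λ e → k ℤ.* a ℤ.+ pow n ℤ.* e) (eval-⊡ k P n))
        (lemma k a (pow n) (eval P n))
  where
  lemma : ∀ k a x p → k ℤ.* a ℤ.+ x ℤ.* (k ℤ.* p) ≡ k ℤ.* (a ℤ.+ x ℤ.* p)
  lemma = solve-∀

eval-⊠ : ∀ P Q n → eval (P ⊠ Q) n ≡ eval P n ℤ.* eval Q n
eval-⊠ []      Q n = sym (ℤₚ.*-zeroˡ (eval Q n))
eval-⊠ (a ∷ P) Q n = begin
  eval (a ⊡ Q ⊞ (0ℤ ∷ P ⊠ Q)) n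
    ≡⟨ eval-⊞ (a ⊡ Q) (0ℤ ∷ P ⊠ Q) n ⟩
  eval (a ⊡ Q) n ℤ.+ (0ℤ ℤ.+ pow n ℤ.* eval (P ⊠ Q) n)
    ≡⟨ cong₂ (λ d e → d ℤ.+ (0ℤ ℤ.+ pow n ℤ.* e)) (eval-⊡ a Q n) (eval-⊠ P Q n) ⟩
  a ℤ.* eval Q n ℤ.+ (0ℤ ℤ.+ pow n ℤ.* (eval P n ℤ.* eval Q n))
    ≡⟨ lemma a (pow n) (eval P n) (eval Q n) ⟩
  eval (a ∷ P) n ℤ.* eval Q n ∎
  where
  open ≡-Reasoning
  lemma : ∀ a x p q →
          a ℤ.* q ℤ.+ (0ℤ ℤ.+ x ℤ.* (p ℤ.* q)) ≡ (a ℤ.+ x ℤ.* p) ℤ.* q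
  lemma = solve-∀

-- Tame sequences and their closure properties

Tame : (ℕ → ℤ) → Set
Tame F = ∃[ c ] ∃[ P ] Eventually (λ n → pow c ℤ.* F n ≡ eval P n)

tame-resp : ∀ {F G} → Eventually (λ n → F n ≡ G n) → Tame F → Tame G
tame-resp F≡G (c , P , p) =
  c , P , ev-zip (λ n e q → trans (cong (pow c ℤ.*_) (sym e)) q) F≡G p

tame-poly : ∀ P → Tame (eval P)
tame-poly P = 0 , P , always (λ n → ℤₚ.*-identityˡ _)

tame-const : ∀ a → Tame (λ _ → a)
tame-const a = tame-resp (always λ n → lemma a (pow n)) (tame-poly (a ∷ []))
  where
  lemma : ∀ a x → a ℤ.+ x ℤ.* 0ℤ ≡ a
  lemma = solve-∀

tame-+ : ∀ {F G} → Tame F → Tame G → Tame (λ n → F n ℤ.+ G n)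
tame-+ {F} {G} (c , P , p) (d , Q , q) =
  c ℕ.+ d , pow d ⊡ P ⊞ pow c ⊡ Q , ev-zip step p q
  where
  open ≡-Reasoning
  lemma : ∀ c d f g → c ℤ.* d ℤ.* (f ℤ.+ g) ≡ d ℤ.* (c ℤ.* f) ℤ.+ c ℤ.* (d ℤ.* g)
  lemma = solve-∀
  step : ∀ n → pow c ℤ.* F n ≡ eval P n → pow d ℤ.* G n ≡ eval Q n →
         pow (c ℕ.+ d) ℤ.* (F n ℤ.+ G n) ≡ eval (pow d ⊡ P ⊞ pow c ⊡ Q) n
  step n e₁ e₂ = begin
    pow (c ℕ.+ d) ℤ.* (F n ℤ.+ G n)
      ≡⟨ cong (ℤ._* (F n ℤ.+ G n)) (pow-+ c d) ⟩
    pow c ℤ.* pow d ℤ.* (F n ℤ.+ G n)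
      ≡⟨ lemma (pow c) (pow d) (F n) (G n) ⟩
    pow d ℤ.* (pow c ℤ.* F n) ℤ.+ pow c ℤ.* (pow d ℤ.* G n)
      ≡⟨ cong₂ (λ a b → pow d ℤ.* a ℤ.+ pow c ℤ.* b) e₁ e₂ ⟩
    pow d ℤ.* eval P n ℤ.+ pow c ℤ.* eval Q n
      ≡⟨ sym (cong₂ ℤ._+_ (eval-⊡ (pow d) P n) (eval-⊡ (pow c) Q n)) ⟩
    eval (pow d ⊡ P) n ℤ.+ eval (pow c ⊡ Q) n
      ≡⟨ sym (eval-⊞ (pow d ⊡ P) (pow c ⊡ Q) n) ⟩
    eval (pow d ⊡ P ⊞ pow c ⊡ Q) n ∎

tame-* : ∀ {F G} → Tame F → Tame G → Tame (λ n → F n ℤ.* G n)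
tame-* {F} {G} (c , P , p) (d , Q , q) = c ℕ.+ d , P ⊠ Q , ev-zip step p q
  where
  open ≡-Reasoning
  lemma : ∀ c d f g → c ℤ.* d ℤ.* (f ℤ.* g) ≡ c ℤ.* f ℤ.* (d ℤ.* g)
  lemma = solve-∀
  step : ∀ n → pow c ℤ.* F n ≡ eval P n → pow d ℤ.* G n ≡ eval Q n →
         pow (c ℕ.+ d) ℤ.* (F n ℤ.* G n) ≡ eval (P ⊠ Q) n
  step n e₁ e₂ = begin
    pow (c ℕ.+ d) ℤ.* (F n ℤ.* G n)
      ≡⟨ cong (ℤ._* (F n ℤ.* G n)) (pow-+ c d) ⟩
    pow c ℤ.* pow d ℤ.* (F n ℤ.* G n)
      ≡⟨ lemma (pow c) (pow d) (F n) (G n) ⟩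
    pow c ℤ.* F n ℤ.* (pow d ℤ.* G n)
      ≡⟨ cong₂ ℤ._*_ e₁ e₂ ⟩
    eval P n ℤ.* eval Q n
      ≡⟨ sym (eval-⊠ P Q n) ⟩
    eval (P ⊠ Q) n ∎

tame-neg : ∀ {F} → Tame F → Tame (λ n → ℤ.- F n)
tame-neg F-tame = tame-resp (always λ n → ℤₚ.-1*i≡-i _) (tame-* (tame-const -1ℤ) F-tame)

-- The halving that ℤ[t] lacks: a quotient by 2ᶜ that is integer-valued merely enlarges the
-- denominator.
tame-÷ : ∀ c {F} → Tame (λ n → pow c ℤ.* F n) → Tame F
tame-÷ c {F} (d , P , p) = d ℕ.+ c , P , ev-map step p
  where
  step : ∀ n → pow d ℤ.* (pow c ℤ.* F n) ≡ eval P n → pow (d ℕ.+ c) ℤ.* F n ≡ eval P n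
  step n e = trans (cong (ℤ._* F n) (pow-+ d c)) (trans (ℤₚ.*-assoc (pow d) (pow c) (F n)) e)

tame-pow : ∀ s k → Tame (λ n → pow (s ℕ.+ k ℕ.* n))
tame-pow s k = tame-resp (always λ n → sym (pow-+ s (k ℕ.* n)))
                         (tame-* (tame-const (pow s)) (lemma k))
  where
  lemma : ∀ k → Tame (λ n → pow (k ℕ.* n))
  lemma zero    = tame-const 1ℤ
  lemma (suc k) = tame-resp (always λ n → sym (pow-+ n (k ℕ.* n)))
                            (tame-* X-tame (lemma k))
    where
    X : ∀ x → 0ℤ ℤ.+ x ℤ.* (1ℤ ℤ.+ x ℤ.* 0ℤ) ≡ x
    X = solve-∀
    X-tame : Tame pow
    X-tame = tame-resp (always λ n → X (pow n)) (tame-poly (0ℤ ∷ 1ℤ ∷ []))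

-- Growth rates and eventual signs

-- Besides fixing the sign, the two-sided bound places `F` within a constant factor of 2ᵏⁿ. This
-- later leaves only finitely many candidates for the largest power of two below an element.
Growth : (ℕ → ℤ) → Set
Growth F = ∃[ k ] ∃[ c ] ∃[ l ] Eventually (λ n →
  pow (k ℕ.* n) ℤ.≤ pow c ℤ.* F n × F n ℤ.≤ pow (l ℕ.+ k ℕ.* n))

pow*F>0⇒F>0 : ∀ c {i} → 0ℤ ℤ.< pow c ℤ.* i → 0ℤ ℤ.< i
pow*F>0⇒F>0 c {i} lt =
  ℤₚ.*-cancelˡ-<-nonNeg (pow c) (subst (ℤ._< pow c ℤ.* i) (sym (ℤₚ.*-zeroʳ (pow c))) lt)

pow>0 : ∀ n → 0ℤ ℤ.< pow n
pow>0 n = ℤ.+<+ (ℕₚ.m^n>0 2 n)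

growth⇒>0 : ∀ {F} → Growth F → Eventually (λ n → 0ℤ ℤ.< F n)
growth⇒>0 (k , c , l , p) =
  ev-map (λ n (lo , _) → pow*F>0⇒F>0 c (ℤₚ.<-≤-trans (pow>0 (k ℕ.* n)) lo)) p

growth-resp : ∀ {F G} → Eventually (λ n → F n ≡ G n) → Growth F → Growth G
growth-resp F≡G (k , c , l , p) = k , c , l ,
  ev-zip (λ n e → subst (λ v → pow (k ℕ.* n) ℤ.≤ pow c ℤ.* v × v ℤ.≤ pow (l ℕ.+ k ℕ.* n)) e) F≡G p

growth-÷ : ∀ c {F} → Growth (λ n → pow c ℤ.* F n) → Growth F
growth-÷ c {F} G@(k , d , l , p) = k , d ℕ.+ c , l , ev-zip step p (growth⇒>0 G)
  where
  step : ∀ n →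
    pow (k ℕ.* n) ℤ.≤ pow d ℤ.* (pow c ℤ.* F n) × pow c ℤ.* F n ℤ.≤ pow (l ℕ.+ k ℕ.* n) →
    0ℤ ℤ.< pow c ℤ.* F n →
    pow (k ℕ.* n) ℤ.≤ pow (d ℕ.+ c) ℤ.* F n × F n ℤ.≤ pow (l ℕ.+ k ℕ.* n)
  step n (lo , hi) cF>0 =
      ℤₚ.≤-trans lo (ℤₚ.≤-reflexive (sym (trans (cong (ℤ._* F n) (pow-+ d c))
                                                (ℤₚ.*-assoc (pow d) (pow c) (F n)))))
    -- Positivity of `F n` gives F ≤ 2ᶜ·F, so the upper bound carries over with the same `l`.
    , ℤₚ.≤-trans (ℤₚ.≤-trans (ℤₚ.≤-reflexive (sym (ℤₚ.*-identityˡ (F n))))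
                             (ℤₚ.*-monoʳ-≤-nonNeg (F n) (ℤₚ.i<j⇒suc[i]≤j (pow>0 c))))
                 hi
    where
    instance
      F≥0 : ℤ.NonNegative (F n)
      F≥0 = ℤ.nonNegative (ℤₚ.<⇒≤ (pow*F>0⇒F>0 c cF>0))

-- The term 2ⁿ·P dominates 2a, so adding a changes it by a factor of at
-- most two either way.
growth-∷ : ∀ a P → Growth (eval P) → Growth (eval (a ∷ P))
growth-∷ a P G@(k , c , l , p) =
  suc k , c ℕ.+ 1 , suc l ,
  ev-zip (λ n (f , b) → step n f b) (ev-zip (λ n → _,_) p (growth⇒>0 G)) (beyond (2 ℕ.* ∣ a ∣))
  where
  open ℤₚ.≤-Reasoning
  step : ∀ n →
    pow (k ℕ.* n) ℤ.≤ pow c ℤ.* eval P n × eval P n ℤ.≤ pow (l ℕ.+ k ℕ.* n) →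
    0ℤ ℤ.< eval P n → 2 ℕ.* ∣ a ∣ ℕ.≤ n →
    pow (suc k ℕ.* n) ℤ.≤ pow (c ℕ.+ 1) ℤ.* (a ℤ.+ pow n ℤ.* eval P n) ×
    a ℤ.+ pow n ℤ.* eval P n ℤ.≤ pow (suc l ℕ.+ suc k ℕ.* n)
  step n (lo , hi) E>0 2a≤n = lower , upper
    where
    X E : ℤ
    X = pow n
    E = eval P n
    X≤XE : X ℤ.≤ X ℤ.* E
    X≤XE = ℤₚ.≤-trans (ℤₚ.≤-reflexive (sym (ℤₚ.*-identityʳ X)))
                      (ℤₚ.*-monoˡ-≤-nonNeg X (ℤₚ.i<j⇒suc[i]≤j E>0))
    ∣2a∣≤X : + (2 ℕ.* ∣ a ∣) ℤ.≤ X
    ∣2a∣≤X = ℤ.+≤+ (ℕₚ.≤-trans 2a≤n (ℕₚ.<⇒≤ (n<2^n n)))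
    i≤∣i∣ : ∀ i → i ℤ.≤ + ∣ i ∣
    i≤∣i∣ (+ n)    = ℤₚ.≤-refl
    i≤∣i∣ -[1+ n ] = ℤ.-≤+
    a≤XE : a ℤ.≤ X ℤ.* E
    a≤XE = ℤₚ.≤-trans (i≤∣i∣ a)
            (ℤₚ.≤-trans (ℤ.+≤+ (ℕₚ.m≤m+n ∣ a ∣ _)) (ℤₚ.≤-trans ∣2a∣≤X X≤XE))
    -2a≤XE : ℤ.- (+ 2 ℤ.* a) ℤ.≤ X ℤ.* E
    -2a≤XE = begin
      ℤ.- (+ 2 ℤ.* a)           ≤⟨ i≤∣i∣ _ ⟩
      + ∣ ℤ.- (+ 2 ℤ.* a) ∣      ≡⟨ cong +_ (ℤₚ.∣-i∣≡∣i∣ (+ 2 ℤ.* a)) ⟩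
      + ∣ + 2 ℤ.* a ∣           ≡⟨ cong +_ (ℤₚ.∣i*j∣≡∣i∣*∣j∣ (+ 2) a) ⟩
      + (2 ℕ.* ∣ a ∣)           ≤⟨ ∣2a∣≤X ⟩
      X                        ≤⟨ X≤XE ⟩
      X ℤ.* E                  ∎
    lemma₁ : ∀ x c e → x ℤ.* (c ℤ.* e) ≡ c ℤ.* (x ℤ.* e)
    lemma₁ = solve-∀
    lemma₂ : ∀ e a → e ≡ e ℤ.+ (+ 2 ℤ.* a) ℤ.+ ℤ.- (+ 2 ℤ.* a)
    lemma₂ = solve-∀
    lemma₃ : ∀ e a → e ℤ.+ (+ 2 ℤ.* a) ℤ.+ e ≡ + 2 ℤ.* (a ℤ.+ e)
    lemma₃ = solve-∀
    lemma₄ : ∀ e → e ℤ.+ e ≡ + 2 ℤ.* e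
    lemma₄ = solve-∀
    lemma₅ : ∀ x l k → + 2 ℤ.* (x ℤ.* (l ℤ.* k)) ≡ + 2 ℤ.* l ℤ.* (x ℤ.* k)
    lemma₅ = solve-∀
    lower = begin
      pow (suc k ℕ.* n)                         ≡⟨ pow-+ n (k ℕ.* n) ⟩
      X ℤ.* pow (k ℕ.* n)                       ≤⟨ ℤₚ.*-monoˡ-≤-nonNeg X lo ⟩
      X ℤ.* (pow c ℤ.* E)                       ≡⟨ lemma₁ X (pow c) E ⟩
      pow c ℤ.* (X ℤ.* E)                       ≡⟨ cong (pow c ℤ.*_) (lemma₂ (X ℤ.* E) a) ⟩
      pow c ℤ.* (X ℤ.* E ℤ.+ (+ 2 ℤ.* a) ℤ.+ ℤ.- (+ 2 ℤ.* a))
        ≤⟨ ℤₚ.*-monoˡ-≤-nonNeg (pow c) (ℤₚ.+-monoʳ-≤ (X ℤ.* E ℤ.+ (+ 2 ℤ.* a)) -2a≤XE) ⟩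
      pow c ℤ.* (X ℤ.* E ℤ.+ (+ 2 ℤ.* a) ℤ.+ X ℤ.* E)
        ≡⟨ cong (pow c ℤ.*_) (lemma₃ (X ℤ.* E) a) ⟩
      pow c ℤ.* (+ 2 ℤ.* (a ℤ.+ X ℤ.* E))         ≡⟨ sym (ℤₚ.*-assoc (pow c) (+ 2) _) ⟩
      pow c ℤ.* + 2 ℤ.* (a ℤ.+ X ℤ.* E)
        ≡⟨ cong (ℤ._* (a ℤ.+ X ℤ.* E)) (sym (pow-+ c 1)) ⟩
      pow (c ℕ.+ 1) ℤ.* (a ℤ.+ X ℤ.* E)          ∎
    upper = begin
      a ℤ.+ X ℤ.* E                             ≤⟨ ℤₚ.+-monoˡ-≤ (X ℤ.* E) a≤XE ⟩
      X ℤ.* E ℤ.+ X ℤ.* E                       ≡⟨ lemma₄ (X ℤ.* E) ⟩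
      + 2 ℤ.* (X ℤ.* E)
        ≤⟨ ℤₚ.*-monoˡ-≤-nonNeg (+ 2) (ℤₚ.*-monoˡ-≤-nonNeg X hi) ⟩
      + 2 ℤ.* (X ℤ.* pow (l ℕ.+ k ℕ.* n))
        ≡⟨ cong (λ v → + 2 ℤ.* (X ℤ.* v)) (pow-+ l (k ℕ.* n)) ⟩
      + 2 ℤ.* (X ℤ.* (pow l ℤ.* pow (k ℕ.* n)))
        ≡⟨ lemma₅ X (pow l) (pow (k ℕ.* n)) ⟩
      + 2 ℤ.* pow l ℤ.* (X ℤ.* pow (k ℕ.* n))
        ≡⟨ sym (cong₂ ℤ._*_ (pow-+ 1 l) (pow-+ n (k ℕ.* n))) ⟩
      pow (suc l) ℤ.* pow (suc k ℕ.* n)         ≡⟨ sym (pow-+ (suc l) (suc k ℕ.* n)) ⟩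
      pow (suc l ℕ.+ suc k ℕ.* n)               ∎

growth-const : ∀ m → Growth (λ _ → + suc m)
growth-const m = 0 , 0 , suc m , always λ n →
    ℤₚ.≤-trans (ℤ.+≤+ (ℕ.s≤s ℕ.z≤n)) (ℤₚ.≤-reflexive (sym (ℤₚ.*-identityˡ (+ suc m))))
  , ℤ.+≤+ (ℕₚ.≤-trans (ℕₚ.<⇒≤ (n<2^n (suc m)))
                       (ℕₚ.≤-reflexive (cong (2 ℕ.^_) (sym (ℕₚ.+-identityʳ (suc m))))))

-- The leading coefficient decides: a nonvanishing tail imposes its sign whatever the head is, and
-- the head matters only when the tail is zero.
poly-sign : ∀ P → (∀ n → eval P n ≡ 0ℤ) ⊎ Growth (eval P) ⊎ Growth (eval (-1ℤ ⊡ P))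
poly-sign []      = inj₁ λ _ → refl
poly-sign (a ∷ P) with poly-sign P
... | inj₂ (inj₁ G) = inj₂ (inj₁ (growth-∷ a P G))
... | inj₂ (inj₂ G) = inj₂ (inj₂ (growth-∷ (-1ℤ ℤ.* a) (-1ℤ ⊡ P) G))
... | inj₁ P≡0      = go a refl
  where
  lemma : ∀ a x → a ≡ a ℤ.+ x ℤ.* 0ℤ
  lemma = solve-∀
  const : ∀ n → a ≡ eval (a ∷ P) n
  const n = trans (lemma a (pow n)) (cong (λ v → a ℤ.+ pow n ℤ.* v) (sym (P≡0 n)))
  go : ∀ b → b ≡ a → (∀ n → eval (a ∷ P) n ≡ 0ℤ) ⊎ Growth (eval (a ∷ P)) ⊎ Growth (eval (-1ℤ ⊡ (a ∷ P)))
  go (+ zero)  b≡a = inj₁ λ n → trans (sym (const n)) (sym b≡a)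
  go (+ suc m) b≡a = inj₂ (inj₁ (growth-resp (always λ n → trans b≡a (const n)) (growth-const m)))
  go -[1+ m ]  b≡a = inj₂ (inj₂ (growth-resp (always λ n → negated n) (growth-const m)))
    where
    negated : ∀ n → + suc m ≡ eval (-1ℤ ⊡ (a ∷ P)) n
    negated n = trans (trans (cong ℤ.-_ b≡a) (sym (ℤₚ.-1*i≡-i a)))
                      (trans (cong (-1ℤ ℤ.*_) (const n)) (sym (eval-⊡ -1ℤ (a ∷ P) n)))

tame-sign : ∀ {F} → Tame F →
            Eventually (λ n → F n ≡ 0ℤ) ⊎ Growth F ⊎ Growth (λ n → ℤ.- F n)
tame-sign {F} (c , P , p) with poly-sign P
... | inj₁ P≡0 =
  inj₁ (ev-map (λ n e → ℤₚ.*-cancelˡ-≡ (pow c) (F n) 0ℤ {{2^≢0 c}}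
                 (trans e (trans (P≡0 n) (sym (ℤₚ.*-zeroʳ (pow c)))))) p)
... | inj₂ (inj₁ G) = inj₂ (inj₁ (growth-÷ c (growth-resp (ev-map (λ n → sym) p) G)))
... | inj₂ (inj₂ G) = inj₂ (inj₂ (growth-÷ c (growth-resp (ev-map step p) G)))
  where
  lemma : ∀ c f → -1ℤ ℤ.* (c ℤ.* f) ≡ c ℤ.* (ℤ.- f)
  lemma = solve-∀
  step : ∀ n → pow c ℤ.* F n ≡ eval P n → eval (-1ℤ ⊡ P) n ≡ pow c ℤ.* (ℤ.- F n)
  step n e = trans (eval-⊡ -1ℤ P n) (trans (cong (-1ℤ ℤ.*_) (sym e)) (lemma (pow c) (F n)))

-- This trichotomy lets the cofinite filter act like an ultrafilter on tame sequences.
tame-compare : ∀ {f g : ℕ → ℕ} → Tame (+_ ∘ f) → Tame (+_ ∘ g) →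
               Eventually (λ n → f n ≡ g n) ⊎
               Eventually (λ n → f n ℕ.< g n) ⊎ Eventually (λ n → g n ℕ.< f n)
tame-compare {f} {g} F G with tame-sign (tame-+ F (tame-neg G))
... | inj₁ f-g≡0     = inj₁ (ev-map (λ n e → ℤₚ.+-injective (ℤₚ.i-j≡0⇒i≡j (+ f n) (+ g n) e)) f-g≡0)
... | inj₂ (inj₁ gr) = inj₂ (inj₂ (ev-map (λ n lt → ℤₚ.drop‿+<+ (shift (+ f n) (+ g n) lt)) (growth⇒>0 gr)))
  where
  lemma : ∀ i j → i ℤ.- j ℤ.+ j ≡ i
  lemma = solve-∀
  shift : ∀ i j → 0ℤ ℤ.< i ℤ.- j → j ℤ.< i
  shift i j lt = subst₂ ℤ._<_ (ℤₚ.+-identityˡ j) (lemma i j) (ℤₚ.+-monoˡ-< j lt)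
... | inj₂ (inj₂ gr) = inj₂ (inj₁ (ev-map (λ n lt → ℤₚ.drop‿+<+ (shift (+ f n) (+ g n) lt)) (growth⇒>0 gr)))
  where
  lemma : ∀ i j → ℤ.- (i ℤ.- j) ℤ.+ i ≡ j
  lemma = solve-∀
  shift : ∀ i j → 0ℤ ℤ.< ℤ.- (i ℤ.- j) → i ℤ.< j
  shift i j lt = subst₂ ℤ._<_ (ℤₚ.+-identityˡ i) (lemma i j) (ℤₚ.+-monoˡ-< i lt)

-- Parity and odd factors

pow-∣ : ∀ {m n} → m ℕ.≤ n → pow m ℤ∣.∣ pow n
pow-∣ {m} {n} m≤n = ℤ∣.divides (pow (n ℕ.∸ m))
  (trans (cong pow (sym (ℕₚ.m∸n+n≡m m≤n))) (pow-+ (n ℕ.∸ m) m))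

-- Dividing 2ᶜF = a + 2ⁿQ by 2ᶜ shows that F is even for large n exactly
-- when 2ᶜ⁺¹ divides a.
tame-parity : ∀ {F} → Tame F →
              Eventually (λ n → + 2 ℤ∣.∣ F n) ⊎ Eventually (λ n → ¬ (+ 2 ℤ∣.∣ F n))
tame-parity {F} (c , [] , p) = inj₁ (ev-map even p)
  where
  even : ∀ n → pow c ℤ.* F n ≡ 0ℤ → + 2 ℤ∣.∣ F n
  even n e = ℤ∣.divides 0ℤ (ℤₚ.*-cancelˡ-≡ (pow c) (F n) 0ℤ {{2^≢0 c}} (trans e (sym (ℤₚ.*-zeroʳ (pow c)))))
tame-parity {F} (c , a ∷ Q , p) with pow (c ℕ.+ 1) ℤ∣.∣? a
... | yes d∣a = inj₁ (ev-zip even p (beyond (c ℕ.+ 1)))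
  where
  even : ∀ n → pow c ℤ.* F n ≡ a ℤ.+ pow n ℤ.* eval Q n → c ℕ.+ 1 ℕ.≤ n → + 2 ℤ∣.∣ F n
  even n e le = ℤ∣.*-cancelˡ-∣ (pow c) {{2^≢0 c}}
    (subst₂ ℤ∣._∣_ (pow-+ c 1) (sym e)
      (ℤ∣.∣m∣n⇒∣m+n d∣a (ℤ∣.∣m⇒∣m*n (eval Q n) (pow-∣ le))))
... | no  d∤a = inj₂ (ev-zip odd p (beyond (c ℕ.+ 1)))
  where
  odd : ∀ n → pow c ℤ.* F n ≡ a ℤ.+ pow n ℤ.* eval Q n → c ℕ.+ 1 ℕ.≤ n → ¬ (+ 2 ℤ∣.∣ F n)
  odd n e le 2∣F = d∤a (ℤ∣.∣m+n∣n⇒∣m {m = a}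
    (subst₂ ℤ∣._∣_ (sym (pow-+ c 1)) e (ℤ∣.*-monoʳ-∣ (pow c) 2∣F))
    (ℤ∣.∣m⇒∣m*n (eval Q n) (pow-∣ le)))

odd-part : ∀ a → ¬ (a ≡ 0ℤ) → ∃[ b ] ∃[ m ] (a ≡ pow b ℤ.* m × ¬ (+ 2 ℤ∣.∣ m))
odd-part a a≢0 = go a a≢0 (<-wellFounded ∣ a ∣)
  where
  go : ∀ a → ¬ (a ≡ 0ℤ) → Acc ℕ._<_ ∣ a ∣ → ∃[ b ] ∃[ m ] (a ≡ pow b ℤ.* m × ¬ (+ 2 ℤ∣.∣ m))
  go a a≢0 (acc rec) with + 2 ℤ∣.∣? a
  ... | no  odd = 0 , a , sym (ℤₚ.*-identityˡ a) , odd
  ... | yes (ℤ∣.divides q a≡q2) = let b , m , q≡ , odd = go q q≢0 (rec q<a) in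
        suc b , m , trans a≡q2 (trans (cong (ℤ._* + 2) q≡) (trans (lemma (pow b) m)
          (cong (ℤ._* m) (sym (pow-+ 1 b))))) , odd
    where
    lemma : ∀ p m → p ℤ.* m ℤ.* + 2 ≡ + 2 ℤ.* p ℤ.* m
    lemma = solve-∀
    q≢0 : ¬ (q ≡ 0ℤ)
    q≢0 q≡0 = a≢0 (trans a≡q2 (cong (ℤ._* + 2) q≡0))
    q<a : ∣ q ∣ ℕ.< ∣ a ∣
    q<a = subst (∣ q ∣ ℕ.<_) (sym (trans (cong ∣_∣ a≡q2) (ℤₚ.∣i*j∣≡∣i∣*∣j∣ q (+ 2))))
            (ℕₚ.m<m*n ∣ q ∣ 2 {{ℤ.≢-nonZero q≢0}} (ℕ.s≤s (ℕ.s≤s ℕ.z≤n)))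

-- The lowest nonzero term governs divisibility by two, since at X = 2ⁿ every later term carries a
-- further factor 2ⁿ. Hence Xⁱ is split off first and then the 2-part of the new constant
-- coefficient.
poly-odd-factor : ∀ P → (∀ n → eval P n ≡ 0ℤ) ⊎
  ∃[ i ] ∃[ b ] ∃[ m ] ∃[ Q ] (¬ (+ 2 ℤ∣.∣ m) ×
    (∀ n → eval P n ≡ pow (i ℕ.* n) ℤ.* eval (pow b ℤ.* m ∷ Q) n))
poly-odd-factor [] = inj₁ λ _ → refl
poly-odd-factor (a ∷ P) with a ℤ.≟ 0ℤ
... | no a≢0 = let b , m , a≡ , odd = odd-part a a≢0 in
      inj₂ (0 , b , m , P , odd ,
            λ n → trans (cong (λ v → eval (v ∷ P) n) a≡) (sym (ℤₚ.*-identityˡ _)))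
... | yes refl with poly-odd-factor P
...   | inj₁ P≡0 = inj₁ λ n → trans (cong (λ v → 0ℤ ℤ.+ pow n ℤ.* v) (P≡0 n)) (lemma (pow n))
  where
  lemma : ∀ x → 0ℤ ℤ.+ x ℤ.* 0ℤ ≡ 0ℤ
  lemma = solve-∀
...   | inj₂ (i , b , m , Q , odd , P≡) = inj₂ (suc i , b , m , Q , odd , λ n →
  trans (cong (λ v → 0ℤ ℤ.+ pow n ℤ.* v) (P≡ n))
        (trans (lemma (pow n) (pow (i ℕ.* n)) _)
               (cong (ℤ._* eval (pow b ℤ.* m ∷ Q) n) (sym (pow-+ n (i ℕ.* n))))))
  where
  lemma : ∀ x y e → 0ℤ ℤ.+ x ℤ.* (y ℤ.* e) ≡ x ℤ.* y ℤ.* e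
  lemma = solve-∀

tame-odd-factor : ∀ {F} → Tame F → Eventually (λ n → F n ≡ 0ℤ) ⊎
  ∃[ c ] ∃[ b ] ∃[ i ] ∃[ W ] (Tame W × Eventually (λ n → ¬ (+ 2 ℤ∣.∣ W n)) ×
    Eventually (λ n → pow c ℤ.* F n ≡ pow (b ℕ.+ i ℕ.* n) ℤ.* W n))
tame-odd-factor {F} (c , P , p) with poly-odd-factor P
... | inj₁ P≡0 = inj₁ (ev-map (λ n e → ℤₚ.*-cancelˡ-≡ (pow c) (F n) 0ℤ {{2^≢0 c}}
                 (trans e (trans (P≡0 n) (sym (ℤₚ.*-zeroʳ (pow c)))))) p)
... | inj₂ (i , b , m , Q , odd , P≡) =
  inj₂ (c , b , i , W , tame-÷ b (tame-resp (ev-map (λ n → sym) scaled) (tame-poly (pow b ℤ.* m ∷ Q)))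
       , (suc b , W-odd) , ev-zip step scaled p)
  where
  W : ℕ → ℤ
  -- This is (2ᵇm + 2ⁿQ)/2ᵇ once n ≥ b; from n > b on the second summand is even, so the parity is
  -- that of `m`.
  W n = m ℤ.+ pow (n ℕ.∸ b) ℤ.* eval Q n
  scaled : Eventually (λ n → pow b ℤ.* W n ≡ eval (pow b ℤ.* m ∷ Q) n)
  scaled = b , λ n b≤n →
    trans (lemma (pow b) m (pow (n ℕ.∸ b)) (eval Q n))
          (cong (λ v → pow b ℤ.* m ℤ.+ v ℤ.* eval Q n)
                (trans (sym (pow-+ b (n ℕ.∸ b))) (cong pow (ℕₚ.m+[n∸m]≡n b≤n))))
    where
    lemma : ∀ b m x q → b ℤ.* (m ℤ.+ x ℤ.* q) ≡ b ℤ.* m ℤ.+ b ℤ.* x ℤ.* q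
    lemma = solve-∀
  W-odd : ∀ n → suc b ℕ.≤ n → ¬ (+ 2 ℤ∣.∣ W n)
  W-odd n b<n 2∣W = odd (ℤ∣.∣m+n∣n⇒∣m {m = m} 2∣W
    (ℤ∣.∣m⇒∣m*n (eval Q n) (pow-∣ {1} (ℕₚ.m<n⇒0<n∸m b<n))))
  step : ∀ n → pow b ℤ.* W n ≡ eval (pow b ℤ.* m ∷ Q) n → pow c ℤ.* F n ≡ eval P n →
         pow c ℤ.* F n ≡ pow (b ℕ.+ i ℕ.* n) ℤ.* W n
  step n s e = begin
    pow c ℤ.* F n                                     ≡⟨ e ⟩
    eval P n                                          ≡⟨ P≡ n ⟩
    pow (i ℕ.* n) ℤ.* eval (pow b ℤ.* m ∷ Q) n         ≡⟨ cong (pow (i ℕ.* n) ℤ.*_) (sym s) ⟩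
    pow (i ℕ.* n) ℤ.* (pow b ℤ.* W n)                  ≡⟨ lemma (pow (i ℕ.* n)) (pow b) (W n) ⟩
    pow b ℤ.* pow (i ℕ.* n) ℤ.* W n                    ≡⟨ cong (ℤ._* W n) (sym (pow-+ b (i ℕ.* n))) ⟩
    pow (b ℕ.+ i ℕ.* n) ℤ.* W n                        ∎
    where
    open ≡-Reasoning
    lemma : ∀ x b w → x ℤ.* (b ℤ.* w) ≡ b ℤ.* x ℤ.* w
    lemma = solve-∀

-- Natural-valued tame sequences, monomials and divisibility

Tameℕ : (ℕ → ℕ) → Set
Tameℕ f = Tame (+_ ∘ f)

tameℕ-resp : ∀ {f g} → Eventually (λ n → f n ≡ g n) → Tameℕ f → Tameℕ g
tameℕ-resp f≡g = tame-resp (ev-map (λ n → cong +_) f≡g)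

tameℕ-+ : ∀ {f g} → Tameℕ f → Tameℕ g → Tameℕ (λ n → f n ℕ.+ g n)
tameℕ-+ = tame-+

tameℕ-* : ∀ {f g} → Tameℕ f → Tameℕ g → Tameℕ (λ n → f n ℕ.* g n)
tameℕ-* {f} {g} F G = tame-resp (always λ n → sym (ℤₚ.pos-* (f n) (g n))) (tame-* F G)

tameℕ-÷ : ∀ c {f} → Tameℕ (λ n → 2 ℕ.^ c ℕ.* f n) → Tameℕ f
tameℕ-÷ c {f} F = tame-÷ c (tame-resp (always λ n → ℤₚ.pos-* (2 ℕ.^ c) (f n)) F)

tameℕ-∸ : ∀ {f g} → Eventually (λ n → g n ℕ.≤ f n) → Tameℕ f → Tameℕ g →
          Tameℕ (λ n → f n ℕ.∸ g n)
tameℕ-∸ {f} {g} g≤f F G =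
  tame-resp (ev-map (λ n le → trans (ℤₚ.m-n≡m⊖n (f n) (g n)) (ℤₚ.⊖-≥ le)) g≤f)
            (tame-+ F (tame-neg G))

-- The sequences 2ᵇ⁺ⁱⁿ/2ᶜ, which turn out to be the powers of two of the model.
Monomial : (ℕ → ℕ) → Set
Monomial f = ∃[ c ] ∃[ b ] ∃[ i ] Eventually (λ n → 2 ℕ.^ c ℕ.* f n ≡ 2 ℕ.^ (b ℕ.+ i ℕ.* n))

monomial⇒tame : ∀ {f} → Monomial f → Tameℕ f
monomial⇒tame (c , b , i , p) = tameℕ-÷ c (tameℕ-resp (ev-map (λ n → sym) p) (tame-pow b i))

2^c*2^e∸c : ∀ {c e} → c ℕ.≤ e → 2 ℕ.^ c ℕ.* 2 ℕ.^ (e ℕ.∸ c) ≡ 2 ℕ.^ e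
2^c*2^e∸c {c} {e} c≤e = trans (sym (ℕₚ.^-distribˡ-+-* 2 c (e ℕ.∸ c))) (cong (2 ℕ.^_) (ℕₚ.m+[n∸m]≡n c≤e))

-- If e < c, cancelling 2ᵉ would leave a positive power of two dividing `w`.
2^∣2^*odd : ∀ c e x w → ¬ (2 ℕ∣.∣ w) → 2 ℕ.^ c ℕ.* x ≡ 2 ℕ.^ e ℕ.* w → c ℕ.≤ e
2^∣2^*odd c e x w odd eq with c ℕ.≤? e
... | yes c≤e = c≤e
... | no  c≰e = ⊥-elim (odd (ℕ∣.∣-trans (ℕ∣.m∣m*n {2} (2 ℕ.^ (c ℕ.∸ suc e)))
      (ℕ∣.divides x (trans (sym (ℕₚ.*-cancelˡ-≡ _ _ (2 ℕ.^ e) {{2^≢0 e}} eq′)) (ℕₚ.*-comm _ x)))))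
  where
  eq′ : 2 ℕ.^ e ℕ.* (2 ℕ.^ suc (c ℕ.∸ suc e) ℕ.* x) ≡ 2 ℕ.^ e ℕ.* w
  eq′ = trans (sym (ℕₚ.*-assoc (2 ℕ.^ e) _ x))
        (trans (cong (ℕ._* x) (trans (sym (ℕₚ.^-distribˡ-+-* 2 e _))
          (cong (2 ℕ.^_) (trans (ℕₚ.+-suc e _) (ℕₚ.m+[n∸m]≡n (ℕₚ.≰⇒> c≰e)))))) eq)

tameℕ-odd-factor : ∀ {x} → Tameℕ x → Eventually (λ n → x n ≡ 0) ⊎
  ∃[ z ] ∃[ w ] (Monomial z × Tameℕ w × Eventually (λ n → ¬ (2 ℕ∣.∣ w n)) ×
    Eventually (λ n → z n ℕ.* w n ≡ x n))
tameℕ-odd-factor {x} X with tame-odd-factor X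
... | inj₁ x≡0 = inj₁ (ev-map (λ n → ℤₚ.+-injective) x≡0)
... | inj₂ (c , b , i , W , W-tame , odd , p) =
  -- Oddness of `W` forces c ≤ e(n), so the truncated subtraction is a true one. The absolute value
  -- changes nothing eventually, because 2ᶜ·x ≥ 0 makes `W` nonnegative.
  inj₂ ((λ n → 2 ℕ.^ (e n ℕ.∸ c)) , (λ n → ∣ W n ∣)
       , (c , b , i , ev-map (λ n → 2^c*2^e∸c) c≤e)
       , tame-resp (ev-map (λ n → sym) +∣W∣≡W) W-tame
       , w-odd
       , ev-zip (λ n le eq → ℕₚ.*-cancelˡ-≡ _ _ (2 ℕ.^ c) {{2^≢0 c}}
           (trans (sym (ℕₚ.*-assoc (2 ℕ.^ c) _ _))
             (trans (cong (ℕ._* ∣ W n ∣) (2^c*2^e∸c le)) (sym eq)))) c≤e eqn)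
  where
  e : ℕ → ℕ
  e n = b ℕ.+ i ℕ.* n
  W≥0 : ∀ n → pow c ℤ.* + x n ≡ pow (e n) ℤ.* W n → 0ℤ ℤ.≤ W n
  W≥0 n eq = ℤₚ.*-cancelˡ-≤-pos 0ℤ (W n) (pow (e n)) {{ℤ.positive (pow>0 (e n))}}
    (subst₂ ℤ._≤_ (sym (ℤₚ.*-zeroʳ (pow (e n)))) (trans (ℤₚ.pos-* (2 ℕ.^ c) (x n)) eq) (ℤ.+≤+ ℕ.z≤n))
  +∣W∣≡W : Eventually (λ n → + ∣ W n ∣ ≡ W n)
  +∣W∣≡W = ev-map (λ n eq → ℤₚ.0≤i⇒+∣i∣≡i (W≥0 n eq)) p
  w-odd : Eventually (λ n → ¬ (2 ℕ∣.∣ ∣ W n ∣))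
  w-odd = ev-map (λ n o 2∣w → o (ℤ∣.∣ᵤ⇒∣ 2∣w)) odd
  eqn : Eventually (λ n → 2 ℕ.^ c ℕ.* x n ≡ 2 ℕ.^ e n ℕ.* ∣ W n ∣)
  eqn = ev-zip (λ n eq w → ℤₚ.+-injective
          (trans (ℤₚ.pos-* (2 ℕ.^ c) (x n)) (trans eq
            (trans (cong (pow (e n) ℤ.*_) (sym w)) (sym (ℤₚ.pos-* (2 ℕ.^ e n) ∣ W n ∣)))))) p +∣W∣≡W
  c≤e : Eventually (λ n → c ℕ.≤ e n)
  c≤e = ev-zip (λ n → 2^∣2^*odd c (e n) (x n) ∣ W n ∣) w-odd eqn

odd∣2^⇒≡1 : ∀ k y z → ¬ (2 ℕ∣.∣ y) → z ℕ.* y ≡ 2 ℕ.^ k → y ≡ 1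
odd∣2^⇒≡1 zero    y z odd eq = ℕₚ.m*n≡1⇒n≡1 z y eq
odd∣2^⇒≡1 (suc k) y z odd eq
  with euclidsLemma z y prime[2] (ℕ∣.divides (2 ℕ.^ k) (trans eq (ℕₚ.*-comm 2 (2 ℕ.^ k))))
... | inj₂ 2∣y = ⊥-elim (odd 2∣y)
... | inj₁ (ℕ∣.divides z′ z≡) = odd∣2^⇒≡1 k y z′ odd (ℕₚ.*-cancelˡ-≡ _ _ 2
        (trans (sym (ℕₚ.*-assoc 2 z′ y)) (trans (cong (ℕ._* y) (trans (ℕₚ.*-comm 2 z′) (sym z≡))) eq)))

-- The parity of `y` settles for large n, so one alternative holds uniformly. An odd divisor of a
-- power of two is 1, and half of an even tame sequence is tame again.
tame-divisor-of-2^ : ∀ {y z : ℕ → ℕ} {α : ℕ → ℕ} → Tameℕ y →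
  Eventually (λ n → z n ℕ.* y n ≡ 2 ℕ.^ α n) →
  Eventually (λ n → y n ≡ 1) ⊎ ∃[ h ] (Tameℕ h × Eventually (λ n → h n ℕ.* 2 ≡ y n))
tame-divisor-of-2^ {y} {z} {α} Y zy≡2^ with tame-parity Y
... | inj₂ odd  = inj₁ (ev-zip (λ n o → odd∣2^⇒≡1 (α n) (y n) (z n) (o ∘ ℤ∣.∣ᵤ⇒∣)) odd zy≡2^)
... | inj₁ even = inj₂ (h , tameℕ-÷ 1 (tameℕ-resp (ev-map (λ n e → trans (sym e) (ℕₚ.*-comm (h n) 2)) halves) Y)
                       , halves)
  where
  h : ℕ → ℕ
  h n = y n ℕ./ 2
  halves : Eventually (λ n → h n ℕ.* 2 ≡ y n)
  halves = ev-map (λ n 2∣y → ℕ÷.m/n*n≡m (ℤ∣.∣⇒∣ᵤ 2∣y)) even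

exponent-≤ : ∀ {A i B j} → Eventually (λ n → A ℕ.+ i ℕ.* n ℕ.≤ B ℕ.+ j ℕ.* n) → i ℕ.≤ j
exponent-≤ {A} {i} {B} {j} (N , p) with i ℕ.≤? j
... | yes i≤j = i≤j
... | no  i≰j = ⊥-elim (ℕₚ.<⇒≱ lt (p n (ℕₚ.m≤m+n N (suc B))))
  where
  -- Large enough to pass the threshold `N` and to exceed the offset `B`, so that one extra multiple
  -- of n outweighs `B`.
  n = N ℕ.+ suc B
  open ℕₚ.≤-Reasoning
  lt : B ℕ.+ j ℕ.* n ℕ.< A ℕ.+ i ℕ.* n
  lt = begin-strict
    B ℕ.+ j ℕ.* n       <⟨ ℕₚ.+-monoˡ-< (j ℕ.* n) (ℕₚ.m≤n+m (suc B) N) ⟩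
    n ℕ.+ j ℕ.* n       ≡⟨⟩
    suc j ℕ.* n         ≤⟨ ℕₚ.*-monoˡ-≤ n (ℕₚ.≰⇒> i≰j) ⟩
    i ℕ.* n             ≤⟨ ℕₚ.m≤n+m (i ℕ.* n) A ⟩
    A ℕ.+ i ℕ.* n       ∎

-- The exponent of the quotient is affine in n with slope j - i. For the quotient to be a monomial
-- this slope must be nonnegative, which `exponent-≤` extracts from x ≤ y.
monomial-∣ : ∀ {x y} → Monomial x → Monomial y → Eventually (λ n → x n ℕ.≤ y n) →
             ∃[ q ] (Tameℕ q × Eventually (λ n → q n ℕ.* x n ≡ y n))
monomial-∣ {x} {y} (c , b , i , p) (d , b′ , j , q) x≤y =
  (λ n → 2 ℕ.^ (B n ℕ.∸ A n)) ,
  monomial⇒tame (d ℕ.+ b , c ℕ.+ b′ , j ℕ.∸ i , ev-map tame A≤B) ,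
  ev-zip (λ n (le , e₁) e₂ → quot n le e₁ e₂) (ev-zip (λ n → _,_) A≤B p) q
  where
  -- The exponents over the common denominator: 2ᴬ = 2ᵈ⁺ᶜ·x and 2ᴮ = 2ᵈ⁺ᶜ·y.
  A B : ℕ → ℕ
  A n = d ℕ.+ b ℕ.+ i ℕ.* n
  B n = c ℕ.+ b′ ℕ.+ j ℕ.* n
  cross : ∀ c d b e f → 2 ℕ.^ c ℕ.* f ≡ 2 ℕ.^ (b ℕ.+ e) →
          2 ℕ.^ (d ℕ.+ b ℕ.+ e) ≡ 2 ℕ.^ (d ℕ.+ c) ℕ.* f
  cross c d b e f eq = trans (cong (2 ℕ.^_) (ℕₚ.+-assoc d b e)) (trans (ℕₚ.^-distribˡ-+-* 2 d (b ℕ.+ e))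
    (trans (cong (2 ℕ.^ d ℕ.*_) (sym eq)) (trans (sym (ℕₚ.*-assoc (2 ℕ.^ d) _ f))
      (cong (ℕ._* f) (sym (ℕₚ.^-distribˡ-+-* 2 d c))))))
  2^A : ∀ n → 2 ℕ.^ c ℕ.* x n ≡ 2 ℕ.^ (b ℕ.+ i ℕ.* n) → 2 ℕ.^ A n ≡ 2 ℕ.^ (d ℕ.+ c) ℕ.* x n
  2^A n = cross c d b (i ℕ.* n) (x n)
  2^B : ∀ n → 2 ℕ.^ d ℕ.* y n ≡ 2 ℕ.^ (b′ ℕ.+ j ℕ.* n) → 2 ℕ.^ B n ≡ 2 ℕ.^ (d ℕ.+ c) ℕ.* y n
  2^B n eq = trans (cross d c b′ (j ℕ.* n) (y n) eq) (cong (λ v → 2 ℕ.^ v ℕ.* y n) (ℕₚ.+-comm c d))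
  A≤B : Eventually (λ n → A n ℕ.≤ B n)
  A≤B = ev-zip (λ n (e₁ , e₂) le → 2^-cancel-≤
          (subst₂ ℕ._≤_ (sym (2^A n e₁)) (sym (2^B n e₂)) (ℕₚ.*-monoʳ-≤ (2 ℕ.^ (d ℕ.+ c)) le)))
          (ev-zip (λ n → _,_) p q) x≤y
  i≤j : i ℕ.≤ j
  i≤j = exponent-≤ A≤B
  tame : ∀ n → A n ℕ.≤ B n →
         2 ℕ.^ (d ℕ.+ b) ℕ.* 2 ℕ.^ (B n ℕ.∸ A n) ≡ 2 ℕ.^ (c ℕ.+ b′ ℕ.+ (j ℕ.∸ i) ℕ.* n)
  tame n le = trans (sym (ℕₚ.^-distribˡ-+-* 2 (d ℕ.+ b) _)) (cong (2 ℕ.^_)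
    (ℕₚ.+-cancelʳ-≡ (i ℕ.* n) _ _ (begin
      d ℕ.+ b ℕ.+ (B n ℕ.∸ A n) ℕ.+ i ℕ.* n    ≡⟨ ℕₚ.+-assoc (d ℕ.+ b) _ _ ⟩
      d ℕ.+ b ℕ.+ (B n ℕ.∸ A n ℕ.+ i ℕ.* n)    ≡⟨ cong (d ℕ.+ b ℕ.+_) (ℕₚ.+-comm _ (i ℕ.* n)) ⟩
      d ℕ.+ b ℕ.+ (i ℕ.* n ℕ.+ (B n ℕ.∸ A n))  ≡⟨ sym (ℕₚ.+-assoc (d ℕ.+ b) _ _) ⟩
      A n ℕ.+ (B n ℕ.∸ A n)                   ≡⟨ ℕₚ.m+[n∸m]≡n le ⟩
      c ℕ.+ b′ ℕ.+ j ℕ.* n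
        ≡⟨ cong (λ v → c ℕ.+ b′ ℕ.+ v ℕ.* n) (sym (ℕₚ.m∸n+n≡m i≤j)) ⟩
      c ℕ.+ b′ ℕ.+ (j ℕ.∸ i ℕ.+ i) ℕ.* n
        ≡⟨ cong (c ℕ.+ b′ ℕ.+_) (ℕₚ.*-distribʳ-+ n (j ℕ.∸ i) i) ⟩
      c ℕ.+ b′ ℕ.+ ((j ℕ.∸ i) ℕ.* n ℕ.+ i ℕ.* n) ≡⟨ sym (ℕₚ.+-assoc (c ℕ.+ b′) _ _) ⟩
      c ℕ.+ b′ ℕ.+ (j ℕ.∸ i) ℕ.* n ℕ.+ i ℕ.* n  ∎)))
    where open ≡-Reasoning
  quot : ∀ n → A n ℕ.≤ B n → 2 ℕ.^ c ℕ.* x n ≡ 2 ℕ.^ (b ℕ.+ i ℕ.* n) →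
         2 ℕ.^ d ℕ.* y n ≡ 2 ℕ.^ (b′ ℕ.+ j ℕ.* n) → 2 ℕ.^ (B n ℕ.∸ A n) ℕ.* x n ≡ y n
  quot n le e₁ e₂ = ℕₚ.*-cancelˡ-≡ _ _ (2 ℕ.^ (d ℕ.+ c)) {{2^≢0 (d ℕ.+ c)}} (begin
    2 ℕ.^ (d ℕ.+ c) ℕ.* (2 ℕ.^ (B n ℕ.∸ A n) ℕ.* x n)  ≡⟨ cong (2 ℕ.^ (d ℕ.+ c) ℕ.*_) (ℕₚ.*-comm _ (x n)) ⟩
    2 ℕ.^ (d ℕ.+ c) ℕ.* (x n ℕ.* 2 ℕ.^ (B n ℕ.∸ A n))  ≡⟨ sym (ℕₚ.*-assoc (2 ℕ.^ (d ℕ.+ c)) (x n) _) ⟩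
    2 ℕ.^ (d ℕ.+ c) ℕ.* x n ℕ.* 2 ℕ.^ (B n ℕ.∸ A n)    ≡⟨ cong (ℕ._* 2 ℕ.^ (B n ℕ.∸ A n)) (sym (2^A n e₁)) ⟩
    2 ℕ.^ A n ℕ.* 2 ℕ.^ (B n ℕ.∸ A n)                 ≡⟨ 2^c*2^e∸c le ⟩
    2 ℕ.^ B n                                        ≡⟨ 2^B n e₂ ⟩
    2 ℕ.^ (d ℕ.+ c) ℕ.* y n                           ∎)
    where open ≡-Reasoning

-- Choosing the exponent separately for each n would give no control over its shape. Comparing `H`
-- with whole sequences 2ˡ⁺ᵏⁿ, lowering `l` until one no longer exceeds it, yields a single `s`
-- valid for all large n.
2^-bracket : ∀ k {H : ℕ → ℕ} → Tameℕ H → Eventually (λ n → 2 ℕ.^ (k ℕ.* n) ℕ.≤ H n) →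
             ∀ l → Eventually (λ n → H n ℕ.< 2 ℕ.^ (l ℕ.+ k ℕ.* n)) →
             ∃[ s ] (Eventually (λ n → 2 ℕ.^ (s ℕ.+ k ℕ.* n) ℕ.≤ H n) ×
                     Eventually (λ n → H n ℕ.< 2 ℕ.^ suc (s ℕ.+ k ℕ.* n)))
2^-bracket k H-tame lo zero    hi = ⊥-elim (ev-absurd (ev-zip (λ n le lt → ℕₚ.<⇒≱ lt le) lo hi))
2^-bracket k H-tame lo (suc l) hi with tame-compare H-tame (tame-pow l k)
... | inj₁ H≡        = l , ev-map (λ n e → ℕₚ.≤-reflexive (sym e)) H≡ , hi
... | inj₂ (inj₁ H<) = 2^-bracket k H-tame lo l H<
... | inj₂ (inj₂ H>) = l , ev-map (λ n → ℕₚ.<⇒≤) H> , hi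

tame-floor : ∀ {h} → Tameℕ h → Eventually (λ n → 0 ℕ.< h n) →
  ∃[ α ] (Tameℕ (λ n → 2 ℕ.^ α n) × Eventually (λ n → 2 ℕ.^ α n ℕ.≤ h n) ×
                              Eventually (λ n → h n ℕ.< 2 ℕ.^ suc (α n)))
tame-floor {h} h-tame h>0 with tame-sign h-tame
... | inj₁ h≡0        = ⊥-elim (ev-absurd (ev-zip (λ n lt e → ℕₚ.<⇒≢ lt (sym (ℤₚ.+-injective e))) h>0 h≡0))
... | inj₂ (inj₂ neg) = ⊥-elim (ev-absurd (ev-zip h<0⇒⊥ h>0 (growth⇒>0 neg)))
  where
  h<0⇒⊥ : ∀ n → 0 ℕ.< h n → 0ℤ ℤ.< ℤ.- + h n → ⊥
  h<0⇒⊥ n lt lt′ = ℤₚ.<-asym (ℤ.+<+ lt)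
    (subst (ℤ._< 0ℤ) (ℤₚ.neg-involutive (+ h n)) (ℤₚ.neg-mono-< lt′))
... | inj₂ (inj₁ (k , c , l , p)) = conclude (2^-bracket k H-tame lo (suc (c ℕ.+ l)) hi)
  where
  -- Scaling by 2ᶜ turns the lower growth bound into exactly 2ᵏⁿ, where the bracketing search
  -- bottoms out.
  H : ℕ → ℕ
  H n = 2 ℕ.^ c ℕ.* h n
  H-tame : Tameℕ H
  H-tame = tameℕ-* (tame-const (pow c)) h-tame
  lo : Eventually (λ n → 2 ℕ.^ (k ℕ.* n) ℕ.≤ H n)
  lo = ev-map (λ n (le , _) → ℤₚ.drop‿+≤+ (subst (pow (k ℕ.* n) ℤ.≤_) (sym (ℤₚ.pos-* (2 ℕ.^ c) (h n))) le)) p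
  hi : Eventually (λ n → H n ℕ.< 2 ℕ.^ (suc (c ℕ.+ l) ℕ.+ k ℕ.* n))
  hi = ev-map (λ n (_ , le) → let open ℕₚ.≤-Reasoning in begin-strict
    2 ℕ.^ c ℕ.* h n                        ≤⟨ ℕₚ.*-monoʳ-≤ (2 ℕ.^ c) (ℤₚ.drop‿+≤+ le) ⟩
    2 ℕ.^ c ℕ.* 2 ℕ.^ (l ℕ.+ k ℕ.* n)       ≡⟨ sym (ℕₚ.^-distribˡ-+-* 2 c _) ⟩
    2 ℕ.^ (c ℕ.+ (l ℕ.+ k ℕ.* n))          ≡⟨ cong (2 ℕ.^_) (sym (ℕₚ.+-assoc c l _)) ⟩
    2 ℕ.^ (c ℕ.+ l ℕ.+ k ℕ.* n)            <⟨ ℕₚ.^-monoʳ-< 2 (ℕ.s≤s (ℕ.s≤s ℕ.z≤n)) (ℕₚ.n<1+n (c ℕ.+ l ℕ.+ k ℕ.* n)) ⟩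
    2 ℕ.^ (suc (c ℕ.+ l) ℕ.+ k ℕ.* n)      ∎) p
  conclude : ∃[ s ] (Eventually (λ n → 2 ℕ.^ (s ℕ.+ k ℕ.* n) ℕ.≤ H n) ×
                     Eventually (λ n → H n ℕ.< 2 ℕ.^ suc (s ℕ.+ k ℕ.* n))) →
    ∃[ α ] (Tameℕ (λ n → 2 ℕ.^ α n) × Eventually (λ n → 2 ℕ.^ α n ℕ.≤ h n) ×
                              Eventually (λ n → h n ℕ.< 2 ℕ.^ suc (α n)))
  conclude (s , below , above) =
      α , monomial⇒tame (c , s , k , scaled)
    , ev-zip (λ n e le → ℕₚ.*-cancelˡ-≤ (2 ℕ.^ c) {{2^≢0 c}} (subst (ℕ._≤ H n) (sym e) le)) scaled below
    , ev-zip (λ n e lt → ℕₚ.*-cancelˡ-< (2 ℕ.^ c) _ _ (subst (H n ℕ.<_) (twice n e) lt)) scaled above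
    where
    α : ℕ → ℕ
    α n = s ℕ.+ k ℕ.* n ℕ.∸ c
    -- As h > 0, 2ᶜ ≤ H < 2 · 2ˢ⁺ᵏⁿ, so the exponent is at least `c` and the scaling can be undone
    -- exactly.
    c≤e : Eventually (λ n → c ℕ.≤ s ℕ.+ k ℕ.* n)
    c≤e = ev-zip (λ n lt h>0 → ℕ.s≤s⁻¹ (2^-cancel-< {c} (ℕₚ.≤-<-trans
            (ℕₚ.m≤m*n (2 ℕ.^ c) (h n) {{ℕ.>-nonZero h>0}}) lt))) above h>0
    scaled : Eventually (λ n → 2 ℕ.^ c ℕ.* 2 ℕ.^ α n ≡ 2 ℕ.^ (s ℕ.+ k ℕ.* n))
    scaled = ev-map (λ n → 2^c*2^e∸c) c≤e
    twice : ∀ n → 2 ℕ.^ c ℕ.* 2 ℕ.^ α n ≡ 2 ℕ.^ (s ℕ.+ k ℕ.* n) →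
            2 ℕ.^ suc (s ℕ.+ k ℕ.* n) ≡ 2 ℕ.^ c ℕ.* 2 ℕ.^ suc (α n)
    twice n e = trans (cong (2 ℕ.*_) (sym e)) (trans (sym (ℕₚ.*-assoc 2 (2 ℕ.^ c) _))
      (trans (cong (ℕ._* 2 ℕ.^ α n) (ℕₚ.*-comm 2 (2 ℕ.^ c))) (ℕₚ.*-assoc (2 ℕ.^ c) 2 _)))

-- The model and truth in it

-- No quotient is formed: eventual equality enters as the interpretation of `≐`.
record 𝔐 : Set where
  constructor _,_
  field
    seq  : ℕ → ℕ
    tame : Tameℕ seq
open 𝔐

const : ℕ → 𝔐
const m = (λ _ → m) , tame-const (+ m)

infix 8 _at_
_at_ : ∀ {n} → Vector 𝔐 n → ℕ → Vector ℕ n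
(ρ at k) i = seq (ρ i) k

⟦⟧-tame : ∀ {n} (t : Term n) (ρ : Vector 𝔐 n) → Tameℕ (λ k → ⟦ t ⟧ (ρ at k))
⟦⟧-tame (var i) ρ = tame (ρ i)
⟦⟧-tame 𝟘       ρ = tame-const (+ 0)
⟦⟧-tame 𝟙       ρ = tame-const (+ 1)
⟦⟧-tame (s ⊕ t) ρ = tameℕ-+ (⟦⟧-tame s ρ) (⟦⟧-tame t ρ)
⟦⟧-tame (s ⊙ t) ρ = tameℕ-* (⟦⟧-tame s ρ) (⟦⟧-tame t ρ)

⟦_⟧𝔐 : ∀ {n} → Term n → Vector 𝔐 n → 𝔐
⟦ t ⟧𝔐 ρ = (λ k → ⟦ t ⟧ (ρ at k)) , ⟦⟧-tame t ρ

-- Disjunction and existence are read through a double negation, so that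
-- classical derivations are sound although truth in 𝔐 is not decidable.
infix 1 _⊩_
_⊩_ : ∀ {n} → Vector 𝔐 n → Formula n → Set
ρ ⊩ s ≐ t = Eventually (λ k → ⟦ s ⟧ (ρ at k) ≡ ⟦ t ⟧ (ρ at k))
ρ ⊩ s ≼ t = Eventually (λ k → ⟦ s ⟧ (ρ at k) ℕ.≤ ⟦ t ⟧ (ρ at k))
ρ ⊩ ⊥̇     = ⊥
ρ ⊩ φ ⇒ ψ = ρ ⊩ φ → ρ ⊩ ψ
ρ ⊩ φ ∧ ψ = (ρ ⊩ φ) × (ρ ⊩ ψ)
ρ ⊩ φ ∨ ψ = ¬ ¬ ((ρ ⊩ φ) ⊎ (ρ ⊩ ψ))
ρ ⊩ ∀̇ φ   = ∀ a → a ∷ᵛ ρ ⊩ φ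
ρ ⊩ ∃̇ φ   = ¬ ¬ (∃[ a ] (a ∷ᵛ ρ ⊩ φ))

eventually-≡? : ∀ {f g} → Tameℕ f → Tameℕ g →
  Eventually (λ k → f k ≡ g k) ⊎ Eventually (λ k → ¬ (f k ≡ g k))
eventually-≡? F G with tame-compare F G
... | inj₁ f≡g        = inj₁ f≡g
... | inj₂ (inj₁ f<g) = inj₂ (ev-map (λ _ → ℕₚ.<⇒≢) f<g)
... | inj₂ (inj₂ f>g) = inj₂ (ev-map (λ _ → ℕₚ.>⇒≢) f>g)

eventually-≤? : ∀ {f g} → Tameℕ f → Tameℕ g →
  Eventually (λ k → f k ℕ.≤ g k) ⊎ Eventually (λ k → ¬ (f k ℕ.≤ g k))
eventually-≤? F G with tame-compare F G
... | inj₁ f≡g        = inj₁ (ev-map (λ _ → ℕₚ.≤-reflexive) f≡g)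
... | inj₂ (inj₁ f<g) = inj₁ (ev-map (λ _ → ℕₚ.<⇒≤) f<g)
... | inj₂ (inj₂ f>g) = inj₂ (ev-map (λ _ → ℕₚ.<⇒≱) f>g)

ev-contradiction : ∀ {P : ℕ → Set} → Eventually P → Eventually (λ k → ¬ P k) → ⊥
ev-contradiction p ¬p = ev-absurd (ev-zip (λ _ p ¬p → ¬p p) p ¬p)

-- Only the atoms need an argument beyond logic, and trichotomy decides those. Stability validates
-- `raa` and the eliminations of `∨` and `∃̇`.
stable : ∀ {n} (φ : Formula n) (ρ : Vector 𝔐 n) → ¬ ¬ (ρ ⊩ φ) → ρ ⊩ φ
stable (s ≐ t) ρ ¬¬p = [ id , (λ q → ⊥-elim (¬¬p λ p → ev-contradiction p q)) ]′
                       (eventually-≡? (⟦⟧-tame s ρ) (⟦⟧-tame t ρ))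
stable (s ≼ t) ρ ¬¬p = [ id , (λ q → ⊥-elim (¬¬p λ p → ev-contradiction p q)) ]′
                       (eventually-≤? (⟦⟧-tame s ρ) (⟦⟧-tame t ρ))
stable ⊥̇       ρ ¬¬p = ¬¬p id
stable (φ ⇒ ψ) ρ ¬¬p = λ a → stable ψ ρ (¬¬-map (λ f → f a) ¬¬p)
stable (φ ∧ ψ) ρ ¬¬p = stable φ ρ (¬¬-map proj₁ ¬¬p) , stable ψ ρ (¬¬-map proj₂ ¬¬p)
stable (φ ∨ ψ) ρ ¬¬p = negated-stable ¬¬p
stable (∀̇ φ)   ρ ¬¬p = λ a → stable φ (a ∷ᵛ ρ) (¬¬-map (λ f → f a) ¬¬p)
stable (∃̇ φ)   ρ ¬¬p = negated-stable ¬¬p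

-- Substitution and soundness

⟦renᵗ⟧ : ∀ {m n} (f : Fin m → Fin n) (t : Term m) (ρ : Vector ℕ n) → ⟦ renᵗ f t ⟧ ρ ≡ ⟦ t ⟧ (ρ ∘ f)
⟦renᵗ⟧ f (var i) ρ = refl
⟦renᵗ⟧ f 𝟘       ρ = refl
⟦renᵗ⟧ f 𝟙       ρ = refl
⟦renᵗ⟧ f (s ⊕ t) ρ = cong₂ ℕ._+_ (⟦renᵗ⟧ f s ρ) (⟦renᵗ⟧ f t ρ)
⟦renᵗ⟧ f (s ⊙ t) ρ = cong₂ ℕ._*_ (⟦renᵗ⟧ f s ρ) (⟦renᵗ⟧ f t ρ)

_≈_ : 𝔐 → 𝔐 → Set
a ≈ b = Eventually (λ k → seq a k ≡ seq b k)

-- A record rather than a function type, so that ρ, σ and ρ′ can be inferred.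
record _⊢_↦_ {m n} (ρ : Vector 𝔐 n) (σ : Fin m → Term n) (ρ′ : Vector 𝔐 m) : Set where
  constructor represents
  field represented : ∀ i → ⟦ σ i ⟧𝔐 ρ ≈ ρ′ i
open _⊢_↦_

↦-lift : ∀ {m n} {ρ : Vector 𝔐 n} {σ : Fin m → Term n} {ρ′} a →
         ρ ⊢ σ ↦ ρ′ → (a ∷ᵛ ρ) ⊢ lift σ ↦ (a ∷ᵛ ρ′)
↦-lift {ρ = ρ} {σ} a r = represents λ
  { zero    → always λ _ → refl
  ; (suc i) → ev-map (λ k → trans (⟦renᵗ⟧ suc (σ i) ((a ∷ᵛ ρ) at k))) (represented r i)
  }

⟦subᵗ⟧ : ∀ {m n} {ρ : Vector 𝔐 n} {σ : Fin m → Term n} {ρ′} → ρ ⊢ σ ↦ ρ′ →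
         ∀ t → ⟦ subᵗ σ t ⟧𝔐 ρ ≈ ⟦ t ⟧𝔐 ρ′
⟦subᵗ⟧ r (var i) = represented r i
⟦subᵗ⟧ r 𝟘       = always λ _ → refl
⟦subᵗ⟧ r 𝟙       = always λ _ → refl
⟦subᵗ⟧ r (s ⊕ t) = ev-zip (λ _ → cong₂ ℕ._+_) (⟦subᵗ⟧ r s) (⟦subᵗ⟧ r t)
⟦subᵗ⟧ r (s ⊙ t) = ev-zip (λ _ → cong₂ ℕ._*_) (⟦subᵗ⟧ r s) (⟦subᵗ⟧ r t)

mutual
  -- Implication is contravariant in its premise, so each direction calls the other.
  sub⁻ : ∀ {m n} {ρ : Vector 𝔐 n} {σ : Fin m → Term n} {ρ′} → ρ ⊢ σ ↦ ρ′ →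
         ∀ φ → ρ ⊩ sub σ φ → ρ′ ⊩ φ
  sub⁻ r (s ≐ t) p = ev-zip (λ _ → trans) (ev-zip (λ _ e → trans (sym e)) (⟦subᵗ⟧ r s) p) (⟦subᵗ⟧ r t)
  sub⁻ r (s ≼ t) p = ev-zip (λ _ e le → subst (_ ℕ.≤_) e le) (⟦subᵗ⟧ r t)
                       (ev-zip (λ _ e le → subst (ℕ._≤ _) e le) (⟦subᵗ⟧ r s) p)
  sub⁻ r ⊥̇       p = p
  sub⁻ r (φ ⇒ ψ) p = sub⁻ r ψ ∘ p ∘ sub⁺ r φ
  sub⁻ r (φ ∧ ψ) (p , q) = sub⁻ r φ p , sub⁻ r ψ q
  sub⁻ r (φ ∨ ψ) p = ¬¬-map (⊎-map (sub⁻ r φ) (sub⁻ r ψ)) p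
  sub⁻ r (∀̇ φ)   p = λ a → sub⁻ (↦-lift a r) φ (p a)
  sub⁻ r (∃̇ φ)   p = ¬¬-map (λ (a , q) → a , sub⁻ (↦-lift a r) φ q) p

  sub⁺ : ∀ {m n} {ρ : Vector 𝔐 n} {σ : Fin m → Term n} {ρ′} → ρ ⊢ σ ↦ ρ′ →
         ∀ φ → ρ′ ⊩ φ → ρ ⊩ sub σ φ
  sub⁺ r (s ≐ t) p = ev-zip (λ _ e e′ → trans e (sym e′)) (ev-zip (λ _ → trans) (⟦subᵗ⟧ r s) p) (⟦subᵗ⟧ r t)
  sub⁺ r (s ≼ t) p = ev-zip (λ _ e le → subst (_ ℕ.≤_) (sym e) le) (⟦subᵗ⟧ r t)
                       (ev-zip (λ _ e le → subst (ℕ._≤ _) (sym e) le) (⟦subᵗ⟧ r s) p)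
  sub⁺ r ⊥̇       p = p
  sub⁺ r (φ ⇒ ψ) p = sub⁺ r ψ ∘ p ∘ sub⁻ r φ
  sub⁺ r (φ ∧ ψ) (p , q) = sub⁺ r φ p , sub⁺ r ψ q
  sub⁺ r (φ ∨ ψ) p = ¬¬-map (⊎-map (sub⁺ r φ) (sub⁺ r ψ)) p
  sub⁺ r (∀̇ φ)   p = λ a → sub⁺ (↦-lift a r) φ (p a)
  sub⁺ r (∃̇ φ)   p = ¬¬-map (λ (a , q) → a , sub⁺ (↦-lift a r) φ q) p

↦-weaken : ∀ {n} {ρ : Vector 𝔐 n} a → (a ∷ᵛ ρ) ⊢ var ∘ suc ↦ ρ
↦-weaken a = represents λ _ → always λ _ → refl

↦-instantiate : ∀ {n} {ρ : Vector 𝔐 n} t {a} → ⟦ t ⟧𝔐 ρ ≈ a → ρ ⊢ t ∷ᵛ var ↦ (a ∷ᵛ ρ)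
↦-instantiate t t≈a = represents λ { zero → t≈a ; (suc i) → always λ _ → refl }

weaken : ∀ {n} {ρ : Vector 𝔐 n} a {Γ} → All (ρ ⊩_) Γ → All (a ∷ᵛ ρ ⊩_) (map ↑ Γ)
weaken a = Allₚ.map⁺ ∘ All.map (λ {φ} → sub⁺ (↦-weaken a) φ)

soundness : ∀ {T : Theory} → (∀ {φ} → T φ → []ᵛ ⊩ φ) →
            ∀ {n} {Γ : List (Formula n)} {φ} → T ⍮ Γ ⊢ φ →
            ∀ ρ → All (ρ ⊩_) Γ → ρ ⊩ φ
soundness T-true (axiom {φ} Tφ) ρ γ = sub⁺ (represents {ρ′ = []ᵛ} λ ()) φ (T-true Tφ)
soundness T-true (hyp φ∈Γ) ρ γ = All.lookup γ φ∈Γ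
soundness T-true (raa {φ} d) ρ γ = stable φ ρ λ ¬φ → soundness T-true d ρ (¬φ ∷ γ)
soundness T-true (⇒-intro d) ρ γ = λ p → soundness T-true d ρ (p ∷ γ)
soundness T-true (⇒-elim d e) ρ γ = soundness T-true d ρ γ (soundness T-true e ρ γ)
soundness T-true (∧-intro d e) ρ γ = soundness T-true d ρ γ , soundness T-true e ρ γ
soundness T-true (∧-elimˡ d) ρ γ = proj₁ (soundness T-true d ρ γ)
soundness T-true (∧-elimʳ d) ρ γ = proj₂ (soundness T-true d ρ γ)
soundness T-true (∨-introˡ d) ρ γ = λ ¬p → ¬p (inj₁ (soundness T-true d ρ γ))
soundness T-true (∨-introʳ d) ρ γ = λ ¬p → ¬p (inj₂ (soundness T-true d ρ γ))
soundness T-true (∨-elim {χ = χ} d e f) ρ γ = stable χ ρ (¬¬-map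
  [ (λ p → soundness T-true e ρ (p ∷ γ)) , (λ p → soundness T-true f ρ (p ∷ γ)) ]′
  (soundness T-true d ρ γ))
soundness T-true (∀-intro d) ρ γ = λ a → soundness T-true d (a ∷ᵛ ρ) (weaken a γ)
soundness T-true (∀-elim {φ} d t) ρ γ =
  sub⁺ (↦-instantiate t (always λ _ → refl)) φ (soundness T-true d ρ γ (⟦ t ⟧𝔐 ρ))
soundness T-true (∃-intro {φ} t d) ρ γ = λ ¬p → ¬p
  (⟦ t ⟧𝔐 ρ , sub⁻ (↦-instantiate t (always λ _ → refl)) φ (soundness T-true d ρ γ))
soundness T-true (∃-elim {χ = χ} d e) ρ γ = stable χ ρ (¬¬-map
  (λ (a , p) → sub⁻ (↦-weaken a) χ (soundness T-true e (a ∷ᵛ ρ) (p ∷ weaken a γ)))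
  (soundness T-true d ρ γ))
soundness T-true (≐-refl t) ρ γ = always λ _ → refl
-- Representation is only up to eventual equality, so `s` also represents the value of `t`, and
-- Leibniz's rule becomes two uses of the substitution lemma.
soundness T-true (≐-subst φ {s} {t} d e) ρ γ =
  sub⁺ (↦-instantiate t (always λ _ → refl)) φ
    (sub⁻ (↦-instantiate s {⟦ t ⟧𝔐 ρ} (soundness T-true d ρ γ)) φ (soundness T-true e ρ γ))

-- Persistence of true universal sentences

⟦⟧-cong : ∀ {n} (t : Term n) {ρ ρ′ : Vector ℕ n} → (∀ i → ρ i ≡ ρ′ i) → ⟦ t ⟧ ρ ≡ ⟦ t ⟧ ρ′
⟦⟧-cong (var i) e = e i
⟦⟧-cong 𝟘       e = refl
⟦⟧-cong 𝟙       e = refl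
⟦⟧-cong (s ⊕ t) e = cong₂ ℕ._+_ (⟦⟧-cong s e) (⟦⟧-cong t e)
⟦⟧-cong (s ⊙ t) e = cong₂ ℕ._*_ (⟦⟧-cong s e) (⟦⟧-cong t e)

-- The environments E k only agree pointwise with ρ at k, since functions
-- are not extensional.
decide : ∀ {n} {φ : Formula n} → QuantifierFree φ → (ρ : Vector 𝔐 n) (E : ℕ → Vector ℕ n) →
         (∀ k i → E k i ≡ (ρ at k) i) →
         (ρ ⊩ φ) × Eventually (λ k → E k ⊨ φ) ⊎ (¬ (ρ ⊩ φ)) × Eventually (λ k → ¬ (E k ⊨ φ))
decide (s ≐ t) ρ E E≡ρ with eventually-≡? (⟦⟧-tame s ρ) (⟦⟧-tame t ρ)
... | inj₁ p = inj₁ (p , ev-map (λ k → subst₂ _≡_ (sym (⟦⟧-cong s (E≡ρ k))) (sym (⟦⟧-cong t (E≡ρ k)))) p)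
... | inj₂ p = inj₂ ((λ q → ev-contradiction q p) ,
  ev-map (λ k ¬q q → ¬q (subst₂ _≡_ (⟦⟧-cong s (E≡ρ k)) (⟦⟧-cong t (E≡ρ k)) q)) p)
decide (s ≼ t) ρ E E≡ρ with eventually-≤? (⟦⟧-tame s ρ) (⟦⟧-tame t ρ)
... | inj₁ p = inj₁ (p , ev-map (λ k → subst₂ ℕ._≤_ (sym (⟦⟧-cong s (E≡ρ k))) (sym (⟦⟧-cong t (E≡ρ k)))) p)
... | inj₂ p = inj₂ ((λ q → ev-contradiction q p) ,
  ev-map (λ k ¬q q → ¬q (subst₂ ℕ._≤_ (⟦⟧-cong s (E≡ρ k)) (⟦⟧-cong t (E≡ρ k)) q)) p)
decide ⊥̇ ρ E E≡ρ = inj₂ (id , always λ _ → id)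
decide (φ ⇒ ψ) ρ E E≡ρ with decide φ ρ E E≡ρ | decide ψ ρ E E≡ρ
... | inj₂ (¬p , ¬p∞) | _               = inj₁ (⊥-elim ∘ ¬p , ev-map (λ _ ¬a → ⊥-elim ∘ ¬a) ¬p∞)
... | inj₁ _          | inj₁ (q , q∞)   = inj₁ ((λ _ → q) , ev-map (λ _ b _ → b) q∞)
... | inj₁ (p , p∞)   | inj₂ (¬q , ¬q∞) = inj₂ ((λ f → ¬q (f p)) , ev-zip (λ _ a ¬b f → ¬b (f a)) p∞ ¬q∞)
decide (φ ∧ ψ) ρ E E≡ρ with decide φ ρ E E≡ρ | decide ψ ρ E E≡ρ
... | inj₁ (p , p∞)   | inj₁ (q , q∞)   = inj₁ ((p , q) , ev-zip (λ _ → _,_) p∞ q∞)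
... | inj₂ (¬p , ¬p∞) | _               = inj₂ (¬p ∘ proj₁ , ev-map (λ _ ¬a → ¬a ∘ proj₁) ¬p∞)
... | inj₁ _          | inj₂ (¬q , ¬q∞) = inj₂ (¬q ∘ proj₂ , ev-map (λ _ ¬b → ¬b ∘ proj₂) ¬q∞)
decide (φ ∨ ψ) ρ E E≡ρ with decide φ ρ E E≡ρ | decide ψ ρ E E≡ρ
... | inj₁ (p , p∞)   | _               = inj₁ ((λ ¬r → ¬r (inj₁ p)) , ev-map (λ _ → inj₁) p∞)
... | inj₂ _          | inj₁ (q , q∞)   = inj₁ ((λ ¬r → ¬r (inj₂ q)) , ev-map (λ _ → inj₂) q∞)
... | inj₂ (¬p , ¬p∞) | inj₂ (¬q , ¬q∞) =
  inj₂ ((λ ¬¬r → ¬¬r [ ¬p , ¬q ]′) , ev-zip (λ _ → [_,_]′) ¬p∞ ¬q∞)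

-- Instantiating quantifiers one by one rebuilds the environment with `∷ᵛ`, which agrees with `ρ`
-- only pointwise; hence a copy `ρ′` is returned.
∀-closure-⊨ : ∀ {n} (φ : Formula n) → 𝔑₀⊨ ∀-closure φ → (ρ : Vector ℕ n) →
              ∃[ ρ′ ] ((∀ i → ρ′ i ≡ ρ i) × (ρ′ ⊨ φ))
∀-closure-⊨ {zero}  φ p ρ = []ᵛ , (λ ()) , p
∀-closure-⊨ {suc n} φ p ρ with ∀-closure-⊨ (∀̇ φ) p (ρ ∘ suc)
... | ρ′ , ρ′≡ρ , q = ρ zero ∷ᵛ ρ′ , (λ { zero → refl ; (suc i) → ρ′≡ρ i }) , q (ρ zero)

∀-closure-⊩ : ∀ {n} (φ : Formula n) → (∀ ρ → ρ ⊩ φ) → []ᵛ ⊩ ∀-closure φ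
∀-closure-⊩ {zero}  φ p = p []ᵛ
∀-closure-⊩ {suc n} φ p = ∀-closure-⊩ (∀̇ φ) (λ ρ a → p (a ∷ᵛ ρ))

-- Were φ to fail in the model, `decide` would make it fail in ℕ at almost all coordinates of `ρ`,
-- whereas it holds at every one.
Th∀-true : ∀ {φ} → Th∀[𝔑₀] φ → []ᵛ ⊩ φ
Th∀-true (true {φ = φ} qf p) = ∀-closure-⊩ φ valid
  where
  valid : ∀ ρ → ρ ⊩ φ
  valid ρ with decide qf ρ (λ k → proj₁ (∀-closure-⊨ φ p (ρ at k)))
                           (λ k → proj₁ (proj₂ (∀-closure-⊨ φ p (ρ at k))))
  ... | inj₁ (q , _)  = q
  ... | inj₂ (_ , ¬q) = ⊥-elim (ev-contradiction
                          (always λ k → proj₂ (proj₂ (∀-closure-⊨ φ p (ρ at k)))) ¬q)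

-- Powers of two and the axioms in the model

pow₂-intro : ∀ {n} (ρ : Vector 𝔐 n) i {α : ℕ → ℕ} →
             Eventually (λ k → seq (ρ i) k ≡ 2 ℕ.^ α k) → ρ ⊩ pow₂ (var i)
pow₂-intro ρ i {α} x≡2^ y y∣x ¬goal = y∣x λ (z , zy≡x) →
  [ (λ y≡1 → ¬goal (inj₁ y≡1))
  , (λ (h , h-tame , 2h≡y) → ¬goal (inj₂ λ ¬∃ → ¬∃ ((h , h-tame) , 2h≡y)))
  ]′ (tame-divisor-of-2^ {z = seq z} {α} (tame y) (ev-zip (λ _ → trans) zy≡x x≡2^))

pow₂-odd-divisor : ∀ {n} (ρ : Vector 𝔐 n) i → ρ ⊩ pow₂ (var i) → ∀ z w →
  Eventually (λ k → seq z k ℕ.* seq w k ≡ seq (ρ i) k) →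
  Eventually (λ k → ¬ (2 ℕ∣.∣ seq w k)) → ¬ ¬ Eventually (λ k → seq w k ≡ 1)
pow₂-odd-divisor ρ i x-pow₂ z w zw≡x odd ¬w≡1 = x-pow₂ w (λ ¬∃ → ¬∃ (z , zw≡x))
  [ ¬w≡1
  , (λ even → even λ (h , 2h≡w) →
      ev-absurd (ev-zip (λ k e o → o (ℕ∣.divides (seq h k) (sym e))) 2h≡w odd))
  ]′

-- Split the element into a monomial and an odd cofactor; the cofactor is an odd divisor of a power
-- of two, hence 1.
pow₂⇒monomial : ∀ {n} (ρ : Vector 𝔐 n) i → ρ ⊩ pow₂ (var i) → ¬ ¬ Monomial (seq (ρ i))
pow₂⇒monomial ρ i x-pow₂ ¬mono with tameℕ-odd-factor (tame (ρ i))
-- Zero is excluded by 0 · 3 = 0: it has the odd divisor 3.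
... | inj₁ x≡0 = pow₂-odd-divisor ρ i x-pow₂ (const 0) (const 3) (ev-map (λ _ → sym) x≡0)
  (always λ _ 2∣3 → contradiction (ℕ∣.n∣m⇒m%n≡0 3 2 2∣3) λ ())
  (λ 3≡1 → ev-contradiction 3≡1 (always λ _ ()))
... | inj₂ (z , w , z-mono@(c , b , j , p) , w-tame , odd , zw≡x) =
  pow₂-odd-divisor ρ i x-pow₂ (z , monomial⇒tame z-mono) (w , w-tame) zw≡x odd λ w≡1 →
    ¬mono (c , b , j , ev-zip (λ n e x≡z → trans (cong (2 ℕ.^ c ℕ.*_) x≡z) e) p
      (ev-zip (λ n e e₁ → trans (sym e) (trans (cong (z n ℕ.*_) e₁) (ℕₚ.*-identityʳ (z n)))) zw≡x w≡1))

-- Axioms with quantifier-free matrix are inherited from ℕ; those involving existence or `pow₂` use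
-- the structure of the model. The outermost quantifier binds the highest index, whence the order
-- `λ z y x`.
PA⁻smu-axiom : ∀ {φ} → PA⁻smu φ → Th∀[𝔑₀] φ ⊎ ([]ᵛ ⊩ φ)
PA⁻smu-axiom pa1 = inj₁ (true {1} (_ ≐ _) ℕₚ.+-identityʳ)
PA⁻smu-axiom pa2 = inj₁ (true {2} (_ ≐ _) λ y x → ℕₚ.+-comm x y)
PA⁻smu-axiom pa3 = inj₁ (true {3} (_ ≐ _) λ z y x → ℕₚ.+-assoc x y z)
PA⁻smu-axiom pa4 = inj₁ (true {1} (_ ≐ _) ℕₚ.*-identityʳ)
PA⁻smu-axiom pa5 = inj₁ (true {2} (_ ≐ _) λ y x → ℕₚ.*-comm x y)
PA⁻smu-axiom pa6 = inj₁ (true {3} (_ ≐ _) λ z y x → ℕₚ.*-assoc x y z)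
PA⁻smu-axiom pa7 = inj₁ (true {3} (_ ≐ _) λ z y x → ℕₚ.*-distribˡ-+ x y z)
PA⁻smu-axiom pa8 = inj₁ (true {2} ((_ ≼ _) ∨ (_ ≼ _)) λ y x → ℕₚ.≤-total x y)
PA⁻smu-axiom pa9 = inj₁ (true {3} (((_ ≼ _) ∧ (_ ≼ _)) ⇒ (_ ≼ _)) λ z y x (x≤y , y≤z) → ℕₚ.≤-trans x≤y y≤z)
PA⁻smu-axiom pa10 = inj₁ (true {1} ((_ ≼ _) ⇒ ⊥̇) λ x → ℕₚ.<⇒≱ (ℕₚ.m<m+n x (ℕ.s≤s ℕ.z≤n)))
PA⁻smu-axiom pa11 = inj₁ (true {2} ((_ ≼ _) ⇒ ((_ ≐ _) ∨ (_ ≼ _))) λ y x y≤x →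
  [ (λ y<x → inj₂ (subst (ℕ._≤ x) (ℕₚ.+-comm 1 y) y<x)) , inj₁ ]′ (ℕₚ.m≤n⇒m<n∨m≡n y≤x))
PA⁻smu-axiom pa12 = inj₁ (true {3} ((_ ≼ _) ⇒ (_ ≼ _)) λ z y x → ℕₚ.+-monoˡ-≤ z)
PA⁻smu-axiom pa13 = inj₁ (true {3} ((_ ≼ _) ⇒ (_ ≼ _)) λ z y x → ℕₚ.*-monoˡ-≤ z)
PA⁻smu-axiom pa15 = inj₂ λ y x y≤x ¬∃ → ¬∃
  ( (_ , tameℕ-∸ y≤x (tame x) (tame y))
  , ev-map (λ _ → sym ∘ ℕₚ.m+[n∸m]≡n) y≤x )
PA⁻smu-axiom pa19 = inj₂ λ x ¬∃ →
  let α , u-tame , u≤h , h<2u = tame-floor (tameℕ-+ (tame x) (tame-const (+ 1)))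
                                  (always λ k → ℕₚ.m≤n+m 1 (seq x k))
      u = (λ k → 2 ℕ.^ α k) , u-tame
  in ¬∃ ( u
        , pow₂-intro (u ∷ᵛ x ∷ᵛ []ᵛ) 0F {α} (always λ _ → refl)
        , u≤h
        , ev-map (λ _ → ℕₚ.<⇒≤) h<2u
        , (λ h≡2u → ev-contradiction h≡2u (ev-map (λ _ → ℕₚ.<⇒≢) h<2u)) )
PA⁻smu-axiom pa20 = inj₂ λ y x (x-pow₂ , y-pow₂ , x≤y) ¬∃ →
  pow₂⇒monomial (x ∷ᵛ y ∷ᵛ []ᵛ) 0F x-pow₂ λ x-mono → pow₂⇒monomial (x ∷ᵛ y ∷ᵛ []ᵛ) 1F y-pow₂ λ y-mono →
    let q , q-tame , qx≡y = monomial-∣ x-mono y-mono x≤y in ¬∃ ((q , q-tame) , qx≡y)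

PA⁻smu-true : ∀ {φ} → PA⁻smu φ → []ᵛ ⊩ φ
PA⁻smu-true = [ Th∀-true , id ]′ ∘ PA⁻smu-axiom

-- Failure of division by three

4*m%3≡m%3 : ∀ m → 2 ℕ.* (2 ℕ.* m) ℕ.% 3 ≡ m ℕ.% 3
4*m%3≡m%3 m = trans (cong (ℕ._% 3) (trans (sym (ℕₚ.*-assoc 2 2 m)) (cong (m ℕ.+_) (ℕₚ.*-comm 3 m))))
                    (ℕ÷.[m+kn]%n≡m%n m m 3)

2^even%3≡1 : ∀ m → 2 ℕ.^ (m ℕ.* 2) ℕ.% 3 ≡ 1
2^even%3≡1 zero    = refl
2^even%3≡1 (suc m) = trans (4*m%3≡m%3 (2 ℕ.^ (m ℕ.* 2))) (2^even%3≡1 m)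

2^odd%3≡2 : ∀ m → 2 ℕ.^ suc (m ℕ.* 2) ℕ.% 3 ≡ 2
2^odd%3≡2 zero    = refl
2^odd%3≡2 (suc m) = trans (4*m%3≡m%3 (2 ℕ.^ suc (m ℕ.* 2))) (2^odd%3≡2 m)

-- A tame sequence is eventually equal or eventually unequal to 1, but the
-- remainder 2ⁿ mod 3 alternates between 1 and 2.
2^n%3-not-tame : ∀ {r} → Tameℕ r → ¬ Eventually (λ n → r n ≡ 2 ℕ.^ n ℕ.% 3)
2^n%3-not-tame r-tame r≡ with eventually-≡? r-tame (tame-const (+ 1))
... | inj₁ r≡1 = let N , p = ev-zip (λ n e e₁ → trans (sym e) e₁) r≡ r≡1 in
  contradiction (trans (sym (2^odd%3≡2 N)) (p _ (ℕₚ.m≤n⇒m≤1+n (ℕₚ.m≤m*n N 2)))) λ ()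
... | inj₂ r≢1 = let N , p = ev-zip (λ n e ≢1 → ≢1 ∘ trans e) r≡ r≢1 in
  p _ (ℕₚ.m≤m*n N 2) (2^even%3≡1 N)

pa17-false : ¬ ([]ᵛ ⊩ pa17)
pa17-false p = p 2^ (const 3) (λ 3≡0 → ev-contradiction 3≡0 (always λ _ ()))
  λ (q , ∃r) → ∃r λ (r , (r≤3 , r≢3) , 2^≡3q+r) → 2^n%3-not-tame (tame r)
    (ev-zip (λ n r<3 e → remainder (seq q n) r<3 e) (strict r r≤3 r≢3) 2^≡3q+r)
  where
  2^ : 𝔐
  2^ = (λ n → 2 ℕ.^ n) , tame-resp (always λ n → cong pow (ℕₚ.*-identityˡ n)) (tame-pow 0 1)
  -- In the model `≺` only says that `r` is not eventually equal to 3; trichotomy upgrades this to r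
  -- < 3 for all large n.
  strict : ∀ r → Eventually (λ n → seq r n ℕ.≤ 3) → ¬ Eventually (λ n → seq r n ≡ 3) →
           Eventually (λ n → seq r n ℕ.< 3)
  strict r r≤3 r≢3 with tame-compare (tame r) (tame-const (+ 3))
  ... | inj₁ r≡3        = ⊥-elim (r≢3 r≡3)
  ... | inj₂ (inj₁ r<3) = r<3
  ... | inj₂ (inj₂ r>3) = ⊥-elim (ev-contradiction r≤3 (ev-map (λ _ → ℕₚ.<⇒≱) r>3))
  remainder : ∀ {x r} q → r ℕ.< 3 → x ≡ q ℕ.* 3 ℕ.+ r → r ≡ x ℕ.% 3
  remainder {x} {r} q r<3 e = sym (trans (cong (ℕ._% 3) (trans e (ℕₚ.+-comm (q ℕ.* 3) r)))
    (trans (ℕ÷.[m+kn]%n≡m%n r q 3) (ℕ÷.m<n⇒m%n≡m r<3)))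

corollary12 : ¬ ((PA⁻smu ∪ Th∀[𝔑₀]) ⊢ pa17) × ¬ (PA⁻smu ⊢ pa17)
corollary12 =
    (λ d → pa17-false (soundness [ PA⁻smu-true , Th∀-true ]′ d []ᵛ []))
  , (λ d → pa17-false (soundness PA⁻smu-true d []ᵛ []))
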